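{- The Secluded Path problem in unweighted undirected graphs can be approximated in polynomial time within a ratio of $\sqrt{\Delta}+3$, where $\Delta$ is the maximum degree of the input graph.
   Context: For a graph $G=(V,E)$ and $u\in V$, $N[u]$ is the set consisting of $u$ and its neighbors; for a subgraph $G'$, $N[G']=\bigcup_{u\in V(G')}N[u]$ and $\mathrm{Cost}(G')=|N[G']|$. Secluded Path problem: given $G$ and nodes $s,t$, find an $s$-$t$ path $P$ minimizing $\mathrm{Cost}(P)$. -}

module Defs where

open import Data.Bool using (Bool; true; false)
open import Data.Fin using (Fin; zero; toℕ)
open import Data.Fin.Subset using (Subset; ⋃; ⁅_⁆; _∪_; ∣_∣)
open import Data.List using (List; []; _∷_; map; allFin; head; last; replicate)
open import Data.List.Extrema.Nat using (max)
open import Data.List.Relation.Unary.Linked using (Linked)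
open import Data.List.Relation.Unary.Unique.Propositional using (Unique)
open import Data.Maybe using (just)
open import Data.Nat using (ℕ; suc; _+_; _*_; _∸_; _^_; _≤_)
open import Data.Product using (∃; ∃-syntax; _×_; _,_)
open import Data.Vec as Vec using (Vec; lookup; _[_]≔_)
open import Relation.Binary.PropositionalEquality using (_≡_)

record Graph (n : ℕ) : Set where
  field
    adj        : Fin n → Fin n → Bool
    adj-sym    : ∀ u v → adj u v ≡ adj v u
    adj-irrefl : ∀ u → adj u u ≡ false

  Adjacent : Fin n → Fin n → Set
  Adjacent u v = adj u v ≡ true

  neighbours : Fin n → Subset n
  neighbours u = Vec.tabulate (adj u)

  N[_] : Fin n → Subset n
  N[ u ] = ⁅ u ⁆ ∪ neighbours u

  degree : Fin n → ℕ
  degree u = ∣ neighbours u ∣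

  maxDegree : ℕ
  maxDegree = max 0 (map degree (allFin n))

  record IsPath (s t : Fin n) (P : List (Fin n)) : Set where
    field
      starts : head P ≡ just s
      ends   : last P ≡ just t
      linked : Linked Adjacent P
      simple : Unique P

  cost : List (Fin n) → ℕ
  cost P = ∣ ⋃ (map N[_] P) ∣

  record IsOptimal (s t : Fin n) (P : List (Fin n)) : Set where
    field
      isPath  : IsPath s t P
      minimal : ∀ Q → IsPath s t Q → cost P ≤ cost Q

-- c ≤[√ d + a ]· o  expresses  c ≤ (√d + a)·o  over the reals: this holds
-- trivially if c ≤ a·o, where ∸ truncates to 0, and otherwise amounts to
-- 0 ≤ c − a·o ≤ √d·o, which may be squared.

_≤[√_+_]·_ : ℕ → ℕ → ℕ → ℕ → Set
c ≤[√ d + a ]· o = (c ∸ a * o) ^ 2 ≤ d * o ^ 2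

-- The model of computation is the language WHILE of N. D. Jones,
-- "Computability and Complexity: From a Programming Perspective" (MIT Press,
-- 1997), with nil as the only atom and a conditional. A program works on
-- finitely many variables holding binary trees, and each elementary operation
-- takes one unit of time. Since trees can be represented by pointers to shared
-- cells, unit-cost cons, hd and tl are realistic, and polynomial time here
-- coincides with polynomial time on Turing machines.

infixr 5 _∙_

data Tree : Set where
  nil : Tree
  _∙_ : Tree → Tree → Tree

size : Tree → ℕ
size nil     = 1
size (a ∙ b) = 1 + size a + size b

hdᵗ tlᵗ : Tree → Tree
hdᵗ nil     = nil
hdᵗ (a ∙ _) = a
tlᵗ nil     = nil
tlᵗ (_ ∙ b) = b

data Exp (k : ℕ) : Set where
  var   : Fin k → Exp k
  nil   : Exp k
  cons  : Exp k → Exp k → Exp k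
  hd tl : Exp k → Exp k

infix  7 _:=_
infixr 6 if_then_else_ while_loop_
infixr 5 _⨾_

data Com (k : ℕ) : Set where
  _:=_          : Fin k → Exp k → Com k
  _⨾_           : Com k → Com k → Com k
  if_then_else_ : Exp k → Com k → Com k → Com k
  while_loop_   : Exp k → Com k → Com k

Store : ℕ → Set
Store k = Vec Tree k

module _ {k : ℕ} where

  eval : Exp k → Store k → Tree
  eval (var x)    σ = lookup σ x
  eval nil        σ = nil
  eval (cons e f) σ = eval e σ ∙ eval f σ
  eval (hd e)     σ = hdᵗ (eval e σ)
  eval (tl e)     σ = tlᵗ (eval e σ)

  expTime : Exp k → ℕ
  expTime (var x)    = 1
  expTime nil        = 1
  expTime (cons e f) = 1 + expTime e + expTime f
  expTime (hd e)     = 1 + expTime e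
  expTime (tl e)     = 1 + expTime e

  -- ⟨ C , σ ⟩⇓ σ′ # m : started in store σ, C halts in store σ′ after m units
  -- of time. A test succeeds iff its value is not nil.

  infix 4 ⟨_,_⟩⇓_#_

  data ⟨_,_⟩⇓_#_ : Com k → Store k → Store k → ℕ → Set where
    assign : ∀ {x e σ} →
             ⟨ x := e , σ ⟩⇓ σ [ x ]≔ eval e σ # 1 + expTime e
    seq    : ∀ {C D σ σ′ σ″ m m′} →
             ⟨ C , σ ⟩⇓ σ′ # m → ⟨ D , σ′ ⟩⇓ σ″ # m′ →
             ⟨ C ⨾ D , σ ⟩⇓ σ″ # m + m′
    if-t   : ∀ {e C D σ σ′ a b m} → eval e σ ≡ a ∙ b →
             ⟨ C , σ ⟩⇓ σ′ # m →
             ⟨ if e then C else D , σ ⟩⇓ σ′ # 1 + expTime e + m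
    if-f   : ∀ {e C D σ σ′ m} → eval e σ ≡ nil →
             ⟨ D , σ ⟩⇓ σ′ # m →
             ⟨ if e then C else D , σ ⟩⇓ σ′ # 1 + expTime e + m
    loop   : ∀ {e C σ σ′ σ″ a b m m′} → eval e σ ≡ a ∙ b →
             ⟨ C , σ ⟩⇓ σ′ # m → ⟨ while e loop C , σ′ ⟩⇓ σ″ # m′ →
             ⟨ while e loop C , σ ⟩⇓ σ″ # 1 + expTime e + m + m′
    done   : ∀ {e C σ} → eval e σ ≡ nil →
             ⟨ while e loop C , σ ⟩⇓ σ # 1 + expTime e

-- Variable zero holds the input at the start and the output at the end; all
-- other variables are initially nil.

record Program : Set where
  field
    extraVars : ℕ
    body      : Com (suc extraVars)

Runs : Program → Tree → Tree → ℕ → Set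
Runs A input output m =
  ∃[ σ ] ⟨ body , input Vec.∷ Vec.replicate extraVars nil ⟩⇓ σ # m
       × lookup σ zero ≡ output
  where open Program A

-- A halts on (the encoding of) every instance, in time polynomial in the size
-- of that encoding, with an output as specified. As sizes are positive,
-- monomials c·sizeᵏ dominate all polynomials.

SolvesInPolynomialTime : {I : Set} → (I → Tree) → (I → Tree → Set) → Program → Set
SolvesInPolynomialTime encode Spec A =
  ∃[ c ] ∃[ k ] ∀ i → ∃[ output ] ∃[ m ]
    Runs A (encode i) output m × m ≤ c * size (encode i) ^ k × Spec i output

encodeList : List Tree → Tree
encodeList []       = nil
encodeList (d ∷ ds) = d ∙ encodeList ds

encodeBool : Bool → Tree
encodeBool false = nil
encodeBool true  = nil ∙ nil

-- Vertices are written in unary; this is harmless because the adjacency matrix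
-- already has n² entries.

encodeVertex : ∀ {n} → Fin n → Tree
encodeVertex v = encodeList (replicate (toℕ v) nil)

encodePath : ∀ {n} → List (Fin n) → Tree
encodePath P = encodeList (map encodeVertex P)

encodeGraph : ∀ {n} → Graph n → Tree
encodeGraph {n} G =
  encodeList (map (λ u → encodeList (map (λ v → encodeBool (adj u v)) (allFin n)))
                  (allFin n))
  where open Graph G

record Instance : Set where
  field
    {n} : ℕ
    G   : Graph n
    s t : Fin n

encodeInstance : Instance → Tree
encodeInstance i = encodeGraph G ∙ encodeVertex s ∙ encodeVertex t
  where open Instance i

-- R G c o: a path of cost c counts as good enough in G when the optimum is o.
-- Nothing is asked of the output if s and t are not connected, since then there
-- is no feasible solution.

ApproximateSolution : (∀ {n} → Graph n → ℕ → ℕ → Set) → Instance → Tree → Set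
ApproximateSolution R i output =
  ∃ (IsPath s t) →
  ∃[ P ] output ≡ encodePath P
       × IsPath s t P
       × (∀ P* → IsOptimal s t P* → R G (cost P) (cost P*))
  where
  open Instance i
  open Graph G

SecludedPathApproximableWithin : (∀ {n} → Graph n → ℕ → ℕ → Set) → Set
SecludedPathApproximableWithin R =
  ∃ (SolvesInPolynomialTime encodeInstance (ApproximateSolution R))

{-# OPTIONS --safe #-}

-- Give a vertex v the weight |N[v]|. Bellman–Ford yields an s-t path P of minimum
-- weight, and cost P is at most its weight. So it suffices to find, next to an
-- optimal path P*, some s-t walk of weight at most (a + 3) · cost P*, where
-- a = ⌊√Δ⌋. Shortcut P* to an induced path and follow it greedily: from v, let w
-- be the last vertex whose closed neighbourhood meets N[v]. If at least a + 2
-- vertices lie between v and w, go from v to w through a common neighbour y; if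
-- not, walk on to the next vertex. The weight of y is at most
-- 1 + Δ ≤ (a + 3) · a, so it is paid for by giving the budget a + 3 to each vertex
-- skipped by the jump, except the first and the last one. By inducedness these
-- vertices lie in no closed neighbourhood of a kept vertex, and by the choice of w
-- every vertex lies in at most a + 3 of those neighbourhoods. Hence each vertex of
-- N[P*] is charged at most a + 3.

module Submission where

import Algebra.Properties.CommutativeMonoid.Sum as Sum
open import Data.Bool using (Bool; true; false) renaming (if_then_else_ to ifᵇ_then_else_)
open import Data.Empty using (⊥-elim)
open import Data.Fin using (Fin; zero; suc; _≟_; toℕ; #_)
open import Data.Fin.Properties using (any?; toℕ<n; toℕ-injective)
open import Data.Fin.Subset using (Subset; inside; outside; _∈_; _∉_; _∪_; ⋃; ⁅_⁆; ∣_∣)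
open import Data.Fin.Subset.Properties using (_∈?_; x∈⁅x⁆; x∈⁅y⁆⇒x≡y; x∈p∪q⁺; x∈p∪q⁻; ∉⊥;
  ∣⁅x⁆∣≡1; ∣⊥∣≡0; ∪-identityˡ; ∣p∣≤n; p⊆q⇒∣p∣≤∣q∣)
open import Data.List using (List; []; _∷_; _++_; _ʳ++_; map; length; drop; reverse;
  replicate; allFin; tabulate; head; initLast; _∷ʳ′_) renaming (last to lastElement)
open import Data.List.Extrema.Nat using (xs≤max)
open import Data.List.Membership.Propositional using () renaming (_∈_ to _∈ₗ_)
open import Data.List.Membership.Propositional.Properties using (∈-allFin; ∈-map⁺; ∈-++⁺ˡ; ∈-++⁺ʳ; ∈-∃++)
open import Data.List.Properties using (++-assoc; length-++; length-map; length-reverse;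
  length-tabulate; map-tabulate; reverse-involutive)
open import Data.List.Relation.Unary.All as All using (All; []; _∷_)
import Data.List.Relation.Unary.All.Properties as All
open import Data.List.Relation.Unary.AllPairs using ([]; _∷_)
open import Data.List.Relation.Unary.Any using (here; there)
open import Data.List.Relation.Unary.Linked using (Linked; [-]; _∷_)
open import Data.List.Relation.Unary.Unique.Propositional using (Unique)
open import Data.Maybe using (Maybe; just; nothing)
open import Data.Nat as ℕ hiding (_≟_)
open import Data.Nat.Properties hiding (_≟_)
open import Data.Nat.Tactic.RingSolver using (solve-∀)
open import Data.Product using (∃; ∃-syntax; _×_; _,_; proj₁; proj₂)
open import Data.Sum using (_⊎_; inj₁; inj₂)
open import Data.Unit using (⊤; tt)
open import Data.Vec as Vec using (lookup; _[_]≔_)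
open import Data.Vec.Properties using (lookup∘tabulate; []=⇒lookup; lookup⇒[]=)
open import Function using (_∘_; case_of_)
open import Relation.Binary.PropositionalEquality
open import Relation.Nullary using (Dec; yes; no; ¬_; contradiction)
open import Relation.Nullary.Decidable using (_×-dec_)
open import Relation.Unary using (Decidable)

open import Defs

open Sum +-0-commutativeMonoid using (sum; ∑-distrib-+; sum-cong-≗; sum-replicate-zero)

-- Indicators, sums and double counting.

ind : {P : Set} → Dec P → ℕ
ind (yes _) = 1
ind (no  _) = 0

ind≤1 : {P : Set} (d : Dec P) → ind d ≤ 1
ind≤1 (yes _) = ≤-refl
ind≤1 (no  _) = z≤n

ind-yes : {P : Set} (d : Dec P) → P → ind d ≡ 1
ind-yes (yes _) _ = refl
ind-yes (no ¬p) p = contradiction p ¬p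

ind-no : {P : Set} (d : Dec P) → ¬ P → ind d ≡ 0
ind-no (yes p) ¬p = contradiction p ¬p
ind-no (no _)  _  = refl

ind-mono : {P Q : Set} (d : Dec P) (e : Dec Q) → (P → Q) → ind d ≤ ind e
ind-mono (yes p) e f = ≤-reflexive (sym (ind-yes e (f p)))
ind-mono (no _)  e f = z≤n

sum-mono-≤ : ∀ {n} {f g : Fin n → ℕ} → (∀ x → f x ≤ g x) → sum f ≤ sum g
sum-mono-≤ {zero}  h = z≤n
sum-mono-≤ {suc n} h = +-mono-≤ (h zero) (sum-mono-≤ (h ∘ suc))

sum-*ˡ : ∀ {n} k (f : Fin n → ℕ) → sum (λ x → k * f x) ≡ k * sum f
sum-*ˡ {zero}  k f = sym (*-zeroʳ k)
sum-*ˡ {suc n} k f = trans (cong (k * f zero +_) (sum-*ˡ k (f ∘ suc))) (sym (*-distribˡ-+ k (f zero) _))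

∣p∣≡sum : ∀ {n} (p : Subset n) → ∣ p ∣ ≡ sum (λ x → ind (x ∈? p))
∣p∣≡sum Vec.[] = refl
∣p∣≡sum {suc n} (b Vec.∷ p) =
  trans (count-∷ b) (cong (ind (zero ∈? (b Vec.∷ p)) +_) (trans (∣p∣≡sum p) (sum-cong-≗ shift)))
  where
  count-∷ : ∀ b → ∣ b Vec.∷ p ∣ ≡ ind (zero ∈? (b Vec.∷ p)) + ∣ p ∣
  count-∷ inside  = refl
  count-∷ outside = refl
  shift : ∀ x → ind (x ∈? p) ≡ ind (suc x ∈? (b Vec.∷ p))
  shift x with x ∈? p
  ... | yes _ = refl
  ... | no  _ = refl

∣p∪q∣≤∣p∣+∣q∣ : ∀ {n} (p q : Subset n) → ∣ p ∪ q ∣ ≤ ∣ p ∣ + ∣ q ∣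
∣p∪q∣≤∣p∣+∣q∣ Vec.[] Vec.[] = z≤n
∣p∪q∣≤∣p∣+∣q∣ (outside Vec.∷ p) (outside Vec.∷ q) = ∣p∪q∣≤∣p∣+∣q∣ p q
∣p∪q∣≤∣p∣+∣q∣ (outside Vec.∷ p) (inside  Vec.∷ q) =
  ≤-trans (s≤s (∣p∪q∣≤∣p∣+∣q∣ p q)) (≤-reflexive (sym (+-suc ∣ p ∣ ∣ q ∣)))
∣p∪q∣≤∣p∣+∣q∣ (inside  Vec.∷ p) (outside Vec.∷ q) = s≤s (∣p∪q∣≤∣p∣+∣q∣ p q)
∣p∪q∣≤∣p∣+∣q∣ (inside  Vec.∷ p) (inside  Vec.∷ q) =
  s≤s (≤-trans (∣p∪q∣≤∣p∣+∣q∣ p q) (+-monoʳ-≤ ∣ p ∣ (n≤1+n ∣ q ∣)))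

∣⁅x⁆∪p∣ : ∀ {n} x (p : Subset n) → Vec.lookup p x ≡ outside → ∣ ⁅ x ⁆ ∪ p ∣ ≡ suc ∣ p ∣
∣⁅x⁆∪p∣ zero    (outside Vec.∷ p) refl = cong (suc ∘ ∣_∣) (∪-identityˡ p)
∣⁅x⁆∪p∣ (suc x) (outside Vec.∷ p) x∉p  = ∣⁅x⁆∪p∣ x p x∉p
∣⁅x⁆∪p∣ (suc x) (inside  Vec.∷ p) x∉p  = cong suc (∣⁅x⁆∪p∣ x p x∉p)

total : {A : Set} → (A → ℕ) → List A → ℕ
total f []       = 0
total f (x ∷ xs) = f x + total f xs

module _ {A : Set} where

  total-++ : ∀ (f : A → ℕ) xs ys → total f (xs ++ ys) ≡ total f xs + total f ys
  total-++ f []       ys = refl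
  total-++ f (x ∷ xs) ys = trans (cong (f x +_) (total-++ f xs ys)) (sym (+-assoc (f x) _ _))

  total-cong : ∀ {f g : A → ℕ} → (∀ x → f x ≡ g x) → ∀ xs → total f xs ≡ total g xs
  total-cong h []       = refl
  total-cong h (x ∷ xs) = cong₂ _+_ (h x) (total-cong h xs)

  total-1 : ∀ (xs : List A) → total (λ _ → 1) xs ≡ length xs
  total-1 []       = refl
  total-1 (x ∷ xs) = cong suc (total-1 xs)

  total-zero : ∀ {f : A → ℕ} {xs} → All (λ x → f x ≡ 0) xs → total f xs ≡ 0
  total-zero []       = refl
  total-zero (e ∷ es) = cong₂ _+_ e (total-zero es)

  total≤length : ∀ {f : A → ℕ} → (∀ x → f x ≤ 1) → ∀ xs → total f xs ≤ length xs
  total≤length h []       = z≤n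
  total≤length h (x ∷ xs) = +-mono-≤ (h x) (total≤length h xs)

  sum-total : ∀ {n} (g : A → Fin n → ℕ) xs → sum (λ x → total (λ a → g a x) xs) ≡ total (λ a → sum (g a)) xs
  sum-total {n} g []       = sum-replicate-zero n
  sum-total {n} g (a ∷ xs) = trans (∑-distrib-+ (g a) _) (cong (sum (g a) +_) (sum-total g xs))

-- Used with `N[_]`, where it counts the closed neighbourhoods containing `x`, and with `⁅_⁆`, where
-- it is the multiplicity of `x` in `L`.
hits : ∀ {n} → (Fin n → Subset n) → List (Fin n) → Fin n → ℕ
hits f L x = total (λ v → ind (x ∈? f v)) L

-- Double counting of pairs of a list position and a vertex. It allows the weight of a list to be
-- bounded one vertex `x` at a time.
sum-hits : ∀ {n} (f : Fin n → Subset n) L → sum (hits f L) ≡ total (∣_∣ ∘ f) L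
sum-hits f L = trans (sum-total (λ v x → ind (x ∈? f v)) L) (total-cong (λ v → sym (∣p∣≡sum (f v))) L)

hits-∉ : ∀ {n} {f : Fin n → Subset n} {L x} → All (λ v → x ∉ f v) L → hits f L x ≡ 0
hits-∉ {f = f} {x = x} h = total-zero (All.map (λ {v} → ind-no (x ∈? f v)) h)

hits-++ : ∀ {n} (f : Fin n → Subset n) L L′ x → hits f (L ++ L′) x ≡ hits f L x + hits f L′ x
hits-++ f L L′ x = total-++ (λ v → ind (x ∈? f v)) L L′

hits-++ˡ : ∀ {n} (f : Fin n → Subset n) L L′ x → hits f L x ≤ hits f (L ++ L′) x
hits-++ˡ f L L′ x = ≤-trans (m≤m+n (hits f L x) _) (≤-reflexive (sym (hits-++ f L L′ x)))

hits-++ʳ : ∀ {n} (f : Fin n → Subset n) L L′ x → hits f L′ x ≤ hits f (L ++ L′) x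
hits-++ʳ f L L′ x = ≤-trans (m≤n+m (hits f L′ x) _) (≤-reflexive (sym (hits-++ f L L′ x)))

∈⇒∈⋃ : ∀ {n} {f : Fin n → Subset n} {L v x} → v ∈ₗ L → x ∈ f v → x ∈ ⋃ (map f L)
∈⇒∈⋃ (here refl) x∈ = x∈p∪q⁺ (inj₁ x∈)
∈⇒∈⋃ (there v∈) x∈  = x∈p∪q⁺ (inj₂ (∈⇒∈⋃ v∈ x∈))

∈⋃⇒∈ : ∀ {n} {f : Fin n → Subset n} L {x} → x ∈ ⋃ (map f L) → ∃ λ v → v ∈ₗ L × x ∈ f v
∈⋃⇒∈ []      x∈ = contradiction x∈ ∉⊥
∈⋃⇒∈ {f = f} (v ∷ L) x∈ with x∈p∪q⁻ (f v) _ x∈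
... | inj₁ h = v , here refl , h
... | inj₂ h with ∈⋃⇒∈ L h
... | u , u∈ , x∈′ = u , there u∈ , x∈′

∣⋃∣≤total : ∀ {n} (f : Fin n → Subset n) L → ∣ ⋃ (map f L) ∣ ≤ total (∣_∣ ∘ f) L
∣⋃∣≤total {n} f []      = ≤-reflexive (∣⊥∣≡0 n)
∣⋃∣≤total f (v ∷ L) = ≤-trans (∣p∪q∣≤∣p∣+∣q∣ (f v) _) (+-monoʳ-≤ ∣ f v ∣ (∣⋃∣≤total f L))

length-suffix : ∀ {A : Set} (xs ys : List A) → length ys ≤ length (xs ++ ys)
length-suffix xs ys = ≤-trans (m≤n+m _ (length xs)) (≤-reflexive (sym (length-++ xs)))

-- Splitting at the last witness records that everything behind it fails `P`. This drives both the
-- extraction of induced walks and the greedy choice of jumps.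
data Last {A : Set} (P : A → Set) : List A → Set where
  none : ∀ {xs} → All (¬_ ∘ P) xs → Last P xs
  last : ∀ xs {y ys} → P y → All (¬_ ∘ P) ys → Last P (xs ++ y ∷ ys)

last? : ∀ {A : Set} {P : A → Set} → Decidable P → ∀ xs → Last P xs
last? P? [] = none []
last? P? (x ∷ xs) with last? P? xs
... | last ys py ¬p = last (x ∷ ys) py ¬p
... | none ¬p with P? x
...   | yes px = last [] px ¬p
...   | no ¬px = none (¬px ∷ ¬p)

-- The upper bound says that `d` is below the square of `a + 1`. Once `d` equals `a * a + (a + a)`,
-- its successor is exactly that square.
∃√ : ∀ d → ∃ λ a → a * a ≤ d × d ≤ a * a + (a + a)
∃√ zero = 0 , z≤n , z≤n
∃√ (suc d) with ∃√ d
... | a , lo , hi with m≤n⇒m<n∨m≡n hi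
...   | inj₁ d< = a , m≤n⇒m≤1+n lo , d<
...   | inj₂ refl = suc a , ≤-reflexive (lemma a) , ≤-trans (≤-reflexive (sym (lemma a))) (m≤m+n _ _)
  where
  lemma : ∀ a → suc a * suc a ≡ suc (a * a + (a + a))
  lemma = solve-∀

-- Walks and induced walks.

module Walks {n : ℕ} (G : Graph n) where

  open Graph G

  Adjacent-sym : ∀ {u v} → Adjacent u v → Adjacent v u
  Adjacent-sym {u} {v} = trans (adj-sym v u)

  ¬Adjacent-refl : ∀ {v} → ¬ Adjacent v v
  ¬Adjacent-refl {v} a = case trans (sym a) (adj-irrefl v) of λ ()

  v∈N[v] : ∀ v → v ∈ N[ v ]
  v∈N[v] v = x∈p∪q⁺ (inj₁ (x∈⁅x⁆ v))

  Adjacent⇒∈N : ∀ {v x} → Adjacent v x → x ∈ N[ v ]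
  Adjacent⇒∈N {v} {x} a = x∈p∪q⁺ (inj₂ (lookup⇒[]= x _ (trans (lookup∘tabulate (adj v) x) a)))

  ∈N⇒≡⊎Adjacent : ∀ {v x} → x ∈ N[ v ] → x ≡ v ⊎ Adjacent v x
  ∈N⇒≡⊎Adjacent {v} {x} x∈ with x∈p∪q⁻ ⁅ v ⁆ (neighbours v) x∈
  ... | inj₁ h = inj₁ (x∈⁅y⁆⇒x≡y v h)
  ... | inj₂ h = inj₂ (trans (sym (lookup∘tabulate (adj v) x)) ([]=⇒lookup h))

  ∈N-sym : ∀ {v x} → x ∈ N[ v ] → v ∈ N[ x ]
  ∈N-sym x∈ with ∈N⇒≡⊎Adjacent x∈
  ... | inj₁ refl = x∈
  ... | inj₂ a    = Adjacent⇒∈N (Adjacent-sym a)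

  weight : Fin n → ℕ
  weight v = ∣ N[ v ] ∣

  weight≡1+degree : ∀ v → weight v ≡ suc (degree v)
  weight≡1+degree v = ∣⁅x⁆∪p∣ v _ (trans (lookup∘tabulate (adj v) v) (adj-irrefl v))

  degree≤maxDegree : ∀ v → degree v ≤ maxDegree
  degree≤maxDegree v = All.lookup (xs≤max 0 (map degree (allFin n))) (∈-map⁺ degree (∈-allFin v))

  Adjacent⇒1≤degree : ∀ {v u} → Adjacent v u → 1 ≤ degree v
  Adjacent⇒1≤degree {v} {u} a = ≤-trans (≤-reflexive (sym (∣⁅x⁆∣≡1 u)))
    (p⊆q⇒∣p∣≤∣q∣ λ x∈ → subst (_∈ neighbours v) (sym (x∈⁅y⁆⇒x≡y u x∈))
      (lookup⇒[]= u _ (trans (lookup∘tabulate (adj v) u) a)))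

  W : List (Fin n) → ℕ
  W = total weight

  data Walk (t : Fin n) : Fin n → List (Fin n) → Set where
    stop : Walk t t (t ∷ [])
    go   : ∀ {v u P} → Adjacent v u → Walk t u P → Walk t v (v ∷ P)

  Walk-suffix : ∀ {t v w} xs {ys} → Walk t v (xs ++ w ∷ ys) → Walk t w (w ∷ ys)
  Walk-suffix [] stop = stop
  Walk-suffix [] (go a p) = go a p
  Walk-suffix (x ∷ []) (go a p) = Walk-suffix [] p
  Walk-suffix (x ∷ y ∷ xs) (go a p) = Walk-suffix (y ∷ xs) p

  -- As neighbourhoods are closed, this excludes repetitions as well as chords.

  data Induced : List (Fin n) → Set where
    []  : Induced []
    _∷_ : ∀ {v P} → All (_∉ N[ v ]) (drop 1 P) → Induced P → Induced (v ∷ P)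

  Induced-suffix : ∀ xs {ys} → Induced (xs ++ ys) → Induced ys
  Induced-suffix []       i       = i
  Induced-suffix (x ∷ xs) (_ ∷ i) = Induced-suffix xs i

  -- The vertex `p` is left out because it may directly follow `x`, and `Induced` exempts
  -- consecutive vertices.
  Induced-∉ : ∀ {x p} xs {ys} → Induced (xs ++ p ∷ ys) → x ∈ₗ xs → All (_∉ N[ x ]) ys
  Induced-∉ (x ∷ [])     (h ∷ i) (here refl) = h
  Induced-∉ (x ∷ y ∷ xs) (h ∷ i) (here refl) = All.tail (All.++⁻ʳ xs h)
  Induced-∉ (x ∷ xs)     (h ∷ i) (there x∈)  = Induced-∉ xs i x∈


  Walk-head : ∀ {t v P} → Walk t v P → P ≡ v ∷ drop 1 P
  Walk-head stop     = refl
  Walk-head (go _ _) = refl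

  -- The second vertex differs from the first since no vertex is adjacent to itself; all later ones
  -- avoid `N[ v ]`, which contains `v`.
  Induced-simple : ∀ {t v P} → Walk t v P → Induced P → ∀ x → hits ⁅_⁆ P x ≤ 1
  Induced-simple {t} stop i x = ≤-trans (≤-reflexive (+-identityʳ _)) (ind≤1 (x ∈? ⁅ t ⁆))
  Induced-simple {v = v} (go {P = P} a p) (h ∷ i) x with x ∈? ⁅ v ⁆
  ... | no _ = Induced-simple p i x
  ... | yes x∈ rewrite x∈⁅y⁆⇒x≡y v x∈ = ≤-reflexive (cong suc (hits-∉ {f = ⁅_⁆} {P} v∉P))
    where
    v∉P : All (λ y → v ∉ ⁅ y ⁆) P
    v∉P rewrite Walk-head p =
      (λ v∈ → ¬Adjacent-refl (subst (Adjacent v) (sym (x∈⁅y⁆⇒x≡y _ v∈)) a))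
      ∷ All.map (λ {y} y∉ v∈ → y∉ (subst (_∈ N[ v ]) (x∈⁅y⁆⇒x≡y y v∈) (v∈N[v] v))) h

  -- From `v` go straight to the last vertex `w` of `P` in `N[ v ]`, cutting out a loop if `w` is
  -- `v`. What follows `w` avoids `N[ v ]`, and the inclusion of tails carries this over to the rest
  -- made induced by recursion. As that rest comes from an arbitrary suffix, the recursion is on a
  -- length bound.
  induce : ∀ k {t v P} → length P ≤ k → Walk t v P →
           ∃ λ P′ → Walk t v P′ × Induced P′ × (∀ {x} → x ∈ₗ drop 1 P′ → x ∈ₗ drop 1 P)
  induce k _ stop = _ , stop , [] ∷ [] , λ x∈ → x∈
  induce (suc k) {t} {v} (s≤s P≤k) (go {u = u} {P} a p)
    with last? (λ w → w ∈? N[ v ]) P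
  ... | none ¬h = ⊥-elim (All.head (subst (All _) (Walk-head p) ¬h) (Adjacent⇒∈N a))
  ... | last xs {w} {ys} w∈ ¬h
    with induce k (≤-trans (length-suffix xs (w ∷ ys)) P≤k) (Walk-suffix xs p)
  ...   | P′ , p′ , i′ , ⊆ with ∈N⇒≡⊎Adjacent w∈
  ...     | inj₁ refl = P′ , p′ , i′ , λ x∈ → ∈-++⁺ʳ xs (there (⊆ x∈))
  ...     | inj₂ a′ = v ∷ P′ , go a′ p′ , All.tabulate (λ x∈ → All.lookup ¬h (⊆ x∈)) ∷ i′ , ∈-++⁺ʳ xs ∘ within
    where
    within : ∀ {x} → x ∈ₗ P′ → x ∈ₗ w ∷ ys
    within x∈ with subst (_ ∈ₗ_) (Walk-head p′) x∈
    ... | here e   = here e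
    ... | there y∈ = there (⊆ y∈)

  Near : Fin n → Fin n → Set
  Near v w = ∃ λ x → x ∈ N[ v ] × x ∈ N[ w ]

  Near? : ∀ v → Decidable (Near v)
  Near? v w = any? (λ x → (x ∈? N[ v ]) ×-dec (x ∈? N[ w ]))

  nbrs copies : List (Fin n) → Fin n → ℕ
  nbrs   = hits N[_]
  copies = hits ⁅_⁆

  cover : List (Fin n) → Fin n → ℕ
  cover P x = ind (x ∈? ⋃ (map N[_] P))

  cover-∈ : ∀ {P v x} → v ∈ₗ P → x ∈ N[ v ] → cover P x ≡ 1
  cover-∈ {P} {x = x} v∈ x∈ = ind-yes (x ∈? ⋃ (map N[_] P)) (∈⇒∈⋃ {f = N[_]} {P} v∈ x∈)

  cover-⊆ : ∀ {P P′} x → (∀ {v} → v ∈ₗ P → v ∈ₗ P′) → cover P x ≤ cover P′ x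
  cover-⊆ {P} x P⊆P′ = ind-mono _ _ λ x∈ → case ∈⋃⇒∈ P x∈ of λ where
    (v , v∈ , x∈N) → ∈⇒∈⋃ (P⊆P′ v∈) x∈N

  copies-≤-∉N : ∀ {x y M P} → (∀ x → copies M x ≤ copies P x) → All (_∉ N[ y ]) P →
                 x ∈ N[ y ] → copies M x ≡ 0
  copies-≤-∉N {x} {y} {M} {P} M⊆P h x∈ = n≤0⇒n≡0 (≤-trans (M⊆P x) (≤-reflexive
    (hits-∉ {f = ⁅_⁆} {P} (All.map (λ {z} z∉ x∈z → z∉ (subst (_∈ N[ y ]) (x∈⁅y⁆⇒x≡y z x∈z) x∈)) h))))

  cover-∉N : ∀ {x P} → All (_∉ N[ x ]) P → cover P x ≡ 0
  cover-∉N {x} {P} h = ind-no (x ∈? ⋃ (map N[_] P)) λ x∈ → case ∈⋃⇒∈ P x∈ of λ where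
    (v , v∈ , x∈N) → All.lookup h v∈ (∈N-sym x∈N)

  copies≢0⇒∈ : ∀ {x} P → copies P x ≢ 0 → x ∈ₗ P
  copies≢0⇒∈ [] h = contradiction refl h
  copies≢0⇒∈ {x} (v ∷ P) h with x ∈? ⁅ v ⁆
  ... | yes x∈ = here (x∈⁅y⁆⇒x≡y v x∈)
  ... | no _   = there (copies≢0⇒∈ P h)

  nbrs-far : ∀ {v x L} → x ∈ N[ v ] → All (¬_ ∘ Near v) L → nbrs L x ≡ 0
  nbrs-far {x = x} {L} x∈ far = hits-∉ {f = N[_]} {L} (All.map (λ ¬near x∈′ → ¬near (x , x∈ , x∈′)) far)

  -- The greedy shortcut of an induced walk.

  module _ (a : ℕ) (Δ≤ : maxDegree ≤ a * a + (a + a)) where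

    c : ℕ
    c = 3 + a

    -- Q is built from the vertices v ∷ R that are kept of the walk v ∷ P and from
    -- the vertices through which it jumps, whose weight is charged to M.

    record Shortcut (t v : Fin n) (P : List (Fin n)) : Set where
      field
        Q R M   : List (Fin n)
        walk    : Walk t v Q
        short   : length Q ≤ suc (length P)
        light   : W Q ≤ W (v ∷ R) + c * length M
        R⊆P     : ∀ x → nbrs R x ≤ nbrs P x
        M⊆P     : ∀ x → copies M x ≤ copies P x
        packing : ∀ x → nbrs (v ∷ R) x + c * copies M x ≤ c * cover (v ∷ P) x

    open Shortcut

    stop-shortcut : ∀ t → Shortcut t t []
    stop-shortcut t = record
      { Q = t ∷ [] ; R = [] ; M = [] ; walk = stop ; short = ≤-refl
      ; light = ≤-reflexive (sym (trans (cong (W (t ∷ []) +_) (*-zeroʳ c)) (+-identityʳ _)))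
      ; R⊆P = λ _ → z≤n ; M⊆P = λ _ → z≤n
      ; packing = λ x → packing′ x }
      where
      packing′ : ∀ x → nbrs (t ∷ []) x + c * 0 ≤ c * cover (t ∷ []) x
      packing′ x with x ∈? N[ t ]
      ... | no _ = ≤-trans (≤-reflexive (*-zeroʳ c)) z≤n
      ... | yes x∈ rewrite cover-∈ {P = t ∷ []} (here refl) x∈ | *-zeroʳ a = s≤s z≤n

    -- At an `x` in `N[ v ]` there is no charge, since charged vertices lie on `P`, which avoids
    -- `N[ v ]`. There `v` adds one neighbourhood to at most `2 + a` others, which gives `c`.
    -- Elsewhere the packing of `S` carries over.
    step-shortcut : ∀ {t v u P} → Adjacent v u → All (_∉ N[ v ]) P →
                    (∀ {x} → x ∈ N[ v ] → nbrs (u ∷ P) x ≤ 2 + a) →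
                    Shortcut t u P → Shortcut t v (u ∷ P)
    step-shortcut {t} {v} {u} {P} v~u i few S = record
      { Q = v ∷ Q S ; R = u ∷ R S ; M = M S ; walk = go v~u (walk S) ; short = s≤s (short S)
      ; light = ≤-trans (+-monoʳ-≤ (weight v) (light S)) (≤-reflexive (sym (+-assoc (weight v) _ _)))
      ; R⊆P = R⊆P′
      ; M⊆P = λ x → ≤-trans (M⊆P S x) (hits-++ʳ ⁅_⁆ (u ∷ []) P x)
      ; packing = packing′ }
      where
      R⊆P′ : ∀ x → nbrs (u ∷ R S) x ≤ nbrs (u ∷ P) x
      R⊆P′ x = +-monoʳ-≤ (ind (x ∈? N[ u ])) (R⊆P S x)
      packing′ : ∀ x → nbrs (v ∷ u ∷ R S) x + c * copies (M S) x ≤ c * cover (v ∷ u ∷ P) x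
      packing′ x with x ∈? N[ v ]
      ... | no _ = ≤-trans (packing S x) (*-monoʳ-≤ c (cover-⊆ {u ∷ P} {v ∷ u ∷ P} x there))
      ... | yes x∈ rewrite cover-∈ {P = v ∷ u ∷ P} (here refl) x∈
                         | copies-≤-∉N {M = M S} (M⊆P S) i x∈ | *-zeroʳ a | *-identityʳ a =
        s≤s (≤-trans (≤-reflexive (+-identityʳ _)) (≤-trans (R⊆P′ x) (few x∈)))

    -- The first and last skipped vertices `p` and `q` are not charged, as they may lie in `N[ v ]`
    -- and `N[ w ]`. A vertex of `mid` lies in no closed neighbourhood of `v` or of a vertex of
    -- `w ∷ P`, so its whole budget `c` is free to pay for `y`.
    jump-shortcut : ∀ {t v p mid q w P} → Walk t v (v ∷ p ∷ mid ++ q ∷ w ∷ P) →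
                    Induced (v ∷ p ∷ mid ++ q ∷ w ∷ P) →
                    a ≤ length mid → Near v w → All (¬_ ∘ Near v) P →
                    Shortcut t w P → Shortcut t v (p ∷ mid ++ q ∷ w ∷ P)
    jump-shortcut {t} {v} {p} {mid} {q} {w} {P} walk₀ ind₀@(h ∷ _ ∷ ind₁) a≤ (y , y∈v , y∈w) far S = record
      { Q = v ∷ y ∷ Q S ; R = w ∷ R S ; M = mid ++ M S
      ; walk = go v~y (go y~w (walk S))
      ; short = ≤-trans (s≤s (s≤s (short S))) (s≤s (s≤s (≤-trans (n≤1+n _) (length-suffix mid (q ∷ w ∷ P)))))
      ; light = light′
      ; R⊆P = λ x → ≤-trans (+-monoʳ-≤ (ind (x ∈? N[ w ])) (R⊆P S x))
          (≤-trans (hits-++ʳ N[_] (q ∷ []) (w ∷ P) x) (hits-++ʳ N[_] (p ∷ mid) (q ∷ w ∷ P) x))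
      ; M⊆P = λ x → begin
          copies (mid ++ M S) x                ≡⟨ hits-++ ⁅_⁆ mid (M S) x ⟩
          copies mid x + copies (M S) x
            ≤⟨ +-monoʳ-≤ (copies mid x) (≤-trans (M⊆P S x) (hits-++ʳ ⁅_⁆ (q ∷ w ∷ []) P x)) ⟩
          copies mid x + copies (q ∷ w ∷ P) x  ≡⟨ sym (hits-++ ⁅_⁆ mid (q ∷ w ∷ P) x) ⟩
          copies (mid ++ q ∷ w ∷ P) x          ≤⟨ hits-++ʳ ⁅_⁆ (p ∷ []) (mid ++ q ∷ w ∷ P) x ⟩
          copies (p ∷ mid ++ q ∷ w ∷ P) x      ∎
      ; packing = packing′ }
      where
      open ≤-Reasoning
      -- Inducedness separates `v` from `w`, so `y` is neither of them, and it is adjacent to both.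
      v∉N[w] : v ∉ N[ w ]
      v∉N[w] v∈ = All.lookup h (∈-++⁺ʳ mid (there (here refl))) (∈N-sym v∈)
      v~y : Adjacent v y
      v~y with ∈N⇒≡⊎Adjacent y∈v
      ... | inj₁ refl = contradiction y∈w v∉N[w]
      ... | inj₂ a′ = a′
      y~w : Adjacent y w
      y~w with ∈N⇒≡⊎Adjacent y∈w
      ... | inj₁ refl = contradiction (∈N-sym y∈v) v∉N[w]
      ... | inj₂ a′ = Adjacent-sym a′
      -- If `a` were 0, all degrees would be 0, but `y` is adjacent to `w`. Hence the 1 in
      -- `1 + degree y` is at most `a`, which makes the weight of `y` at most `(3 + a) * a`.
      1≤a : ∀ a → 1 ≤ a * a + (a + a) → 1 ≤ a
      1≤a (suc a) _ = s≤s z≤n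
      degree≤ : degree y ≤ a * a + (a + a)
      degree≤ = ≤-trans (degree≤maxDegree y) Δ≤
      weight-y : weight y ≤ c * length mid
      weight-y = begin
        weight y                ≡⟨ weight≡1+degree y ⟩
        1 + degree y            ≤⟨ +-mono-≤ (1≤a a (≤-trans (Adjacent⇒1≤degree y~w) degree≤)) degree≤ ⟩
        a + (a * a + (a + a))   ≡⟨ lemma a ⟩
        c * a                   ≤⟨ *-monoʳ-≤ c a≤ ⟩
        c * length mid          ∎
        where
        lemma : ∀ a → a + (a * a + (a + a)) ≡ (3 + a) * a
        lemma = solve-∀
      light′ : W (v ∷ y ∷ Q S) ≤ W (v ∷ w ∷ R S) + c * length (mid ++ M S)
      light′ = begin
        weight v + (weight y + W (Q S))    ≤⟨ +-monoʳ-≤ (weight v) (+-mono-≤ weight-y (light S)) ⟩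
        weight v + (c * length mid + (W (w ∷ R S) + c * length (M S)))
          ≡⟨ lemma (weight v) c (length mid) (W (w ∷ R S)) (length (M S)) ⟩
        (weight v + W (w ∷ R S)) + c * (length mid + length (M S))
          ≡⟨ cong (λ l → (weight v + W (w ∷ R S)) + c * l) (sym (length-++ mid)) ⟩
        W (v ∷ w ∷ R S) + c * length (mid ++ M S)  ∎
        where
        lemma : ∀ a c l b m → a + (c * l + (b + c * m)) ≡ (a + b) + c * (l + m)
        lemma = solve-∀
      P⊆ : ∀ {z} → z ∈ₗ w ∷ P → z ∈ₗ v ∷ p ∷ mid ++ q ∷ w ∷ P
      P⊆ z∈ = there (there (∈-++⁺ʳ mid (there z∈)))
      packing′ : ∀ x → nbrs (v ∷ w ∷ R S) x + c * copies (mid ++ M S) x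
                     ≤ c * cover (v ∷ p ∷ mid ++ q ∷ w ∷ P) x
      packing′ x rewrite total-++ (λ m → ind (x ∈? ⁅ m ⁆)) mid (M S) with x ∈? N[ v ]
      -- Nothing charged lies in `N[ v ]`, and by `far` no neighbourhood of `R S` contains `x`. Only
      -- `v` and `w` can count, and 2 is at most `c`.
      ... | yes x∈ rewrite cover-∈ {P = v ∷ p ∷ mid ++ q ∷ w ∷ P} (here refl) x∈
                         | copies-≤-∉N {M = mid} (λ _ → ≤-refl) (All.++⁻ˡ mid h) x∈
                         | copies-≤-∉N {M = M S} (M⊆P S) (All.tail (All.tail (All.++⁻ʳ mid h))) x∈
                         | *-zeroʳ a | *-identityʳ a = s≤s (≤-trans (≤-reflexive (+-identityʳ _))
          (+-mono-≤ (ind≤1 (x ∈? N[ w ])) (≤-trans (R⊆P S x) (≤-trans (≤-reflexive (nbrs-far x∈ far)) z≤n))))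
      ... | no _ with copies mid x ℕ.≟ 0
      ...   | yes e rewrite e = ≤-trans (packing S x) (*-monoʳ-≤ c (cover-⊆ {w ∷ P} {v ∷ p ∷ mid ++ q ∷ w ∷ P} x P⊆))
      -- As the walk is simple, `x` is charged only once within `mid`. It is outside all
      -- neighbourhoods of `w ∷ P`, so `packing S x` bounds the remaining terms by 0.
      ...   | no ≢0 = begin
        nbrs (w ∷ R S) x + c * (copies mid x + copies (M S) x)
          ≡⟨ lemma (nbrs (w ∷ R S) x) c (copies mid x) (copies (M S) x) ⟩
        c * copies mid x + (nbrs (w ∷ R S) x + c * copies (M S) x)
          ≤⟨ +-mono-≤ (*-monoʳ-≤ c once) (packing S x) ⟩
        c * 1 + c * cover (w ∷ P) x
          ≡⟨ cong₂ (λ k l → c * k + c * l) (sym covered) (cover-∉N {x} {w ∷ P} (Induced-∉ mid ind₁ x∈mid)) ⟩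
        c * cover (v ∷ p ∷ mid ++ q ∷ w ∷ P) x + c * 0
          ≡⟨ trans (cong (c * cover (v ∷ p ∷ mid ++ q ∷ w ∷ P) x +_) (*-zeroʳ c)) (+-identityʳ _) ⟩
        c * cover (v ∷ p ∷ mid ++ q ∷ w ∷ P) x ∎
        where
        lemma : ∀ b c l m → b + c * (l + m) ≡ c * l + (b + c * m)
        lemma = solve-∀
        x∈mid : x ∈ₗ mid
        x∈mid = copies≢0⇒∈ mid ≢0
        covered : cover (v ∷ p ∷ mid ++ q ∷ w ∷ P) x ≡ 1
        covered = cover-∈ {P = v ∷ p ∷ mid ++ q ∷ w ∷ P} (there (there (∈-++⁺ˡ x∈mid))) (v∈N[v] x)
        once : copies mid x ≤ 1
        once = ≤-trans (hits-++ˡ ⁅_⁆ mid (q ∷ w ∷ P) x)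
                 (≤-trans (hits-++ʳ ⁅_⁆ (v ∷ p ∷ []) (mid ++ q ∷ w ∷ P) x) (Induced-simple walk₀ ind₀ x))

    shortcut : ∀ k {t v P} → length P ≤ k → Walk t v (v ∷ P) → Induced (v ∷ P) → Shortcut t v P
    shortcut k _ stop _ = stop-shortcut _
    shortcut (suc k) {t} {v} {u ∷ P} (s≤s P≤k) walk₀@(go v~u′ p) ind₀@(h ∷ i) = by (last? (Near? v) (u ∷ P)) refl
      where
      v~u : Adjacent v u
      v~u with refl ← Walk-head p = v~u′
      p′ : Walk t u (u ∷ P)
      p′ with refl ← Walk-head p = p
      by : ∀ {L} → Last (Near v) L → L ≡ u ∷ P → Shortcut t v (u ∷ P)
      -- This case cannot arise, as `u` is near `v`; an ordinary step covers it with a count of 0.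
      by (none ¬near) refl = step-shortcut v~u h
        (λ x∈ → ≤-trans (≤-reflexive (nbrs-far x∈ ¬near)) z≤n) (shortcut k P≤k p′ i)
      -- `xs` holds the vertices strictly between `v` and `w`. If they are fewer than `2 + a`, they
      -- and `w` account for at most the `2 + a` neighbourhoods that a step allows. Otherwise,
      -- removing both ends of `xs` leaves at least `a` vertices for `mid`.
      by (last xs {w} {ys} near far) e with 2 + a ≤? length xs
      ... | no few = step-shortcut v~u h few′ (shortcut k P≤k p′ i)
        where
        few′ : ∀ {x} → x ∈ N[ v ] → nbrs (u ∷ P) x ≤ 2 + a
        few′ {x} x∈ = begin
          nbrs (u ∷ P) x                ≡⟨ cong (λ L → nbrs L x) (sym e) ⟩
          nbrs (xs ++ w ∷ ys) x         ≡⟨ total-++ _ xs (w ∷ ys) ⟩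
          nbrs xs x + (ind (x ∈? N[ w ]) + nbrs ys x)
            ≤⟨ +-mono-≤ (total≤length (λ z → ind≤1 (x ∈? N[ z ])) xs)
                 (+-mono-≤ (ind≤1 (x ∈? N[ w ])) (≤-reflexive (nbrs-far x∈ far))) ⟩
          length xs + 1                 ≡⟨ +-comm (length xs) 1 ⟩
          suc (length xs)               ≤⟨ ≰⇒> few ⟩
          2 + a                         ∎
          where open ≤-Reasoning
      by (last (x ∷ xs) near far) refl | yes (s≤s many) with initLast xs
      by (last (x ∷ _) {w} {ys} near far) refl | yes (s≤s many) | mid ∷ʳ′ q =
        subst (λ L → Shortcut t v (x ∷ L)) (sym split)
          (jump-shortcut {mid = mid} {q}
             (subst (λ L → Walk t v (v ∷ x ∷ L)) split walk₀) (subst (λ L → Induced (v ∷ x ∷ L)) split ind₀)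
             (≤-pred (≤-trans many (≤-reflexive (trans (length-++ mid) (+-comm (length mid) 1))))) near far
             (shortcut k (≤-trans (≤-trans (n≤1+n _) (length-suffix (mid ++ q ∷ []) (w ∷ ys))) P≤k)
               (Walk-suffix (x ∷ mid ++ q ∷ []) p′) (Induced-suffix (x ∷ mid ++ q ∷ []) i)))
        where
        split : (mid ++ q ∷ []) ++ w ∷ ys ≡ mid ++ q ∷ w ∷ ys
        split = ++-assoc mid (q ∷ []) (w ∷ ys)

    -- Summed over all `x`, the left side of `packing` becomes the bound in `light`, and its right
    -- side at most `c * cost P`. An induced walk visits each vertex at most once, whence the length
    -- bound, by which `n` rounds of Bellman-Ford take `Q` into account.
    light-walk : ∀ {t v P} → Walk t v P → ∃ λ Q → Walk t v Q × length Q ≤ n × W Q ≤ c * cost P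
    light-walk {t} {v} {P} p with induce (length P) ≤-refl p
    ... | P₁ , p₁ , i₁ , ⊆₁ =
      Q S , walk S , ≤-trans (short S) (≤-trans (≤-reflexive (cong length (sym P₁≡))) P₁≤n) , (begin
        W (Q S)
          ≤⟨ light S ⟩
        W (v ∷ R S) + c * length (M S)
          ≡⟨ cong (λ k → W (v ∷ R S) + c * k) (length≡sum (M S)) ⟩
        W (v ∷ R S) + c * sum (copies (M S))
          ≡⟨ cong₂ _+_ (sym (sum-hits N[_] (v ∷ R S))) (sym (sum-*ˡ c (copies (M S)))) ⟩
        sum (nbrs (v ∷ R S)) + sum (λ x → c * copies (M S) x)
          ≡⟨ sym (∑-distrib-+ (nbrs (v ∷ R S)) (λ x → c * copies (M S) x)) ⟩
        sum (λ x → nbrs (v ∷ R S) x + c * copies (M S) x)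
          ≤⟨ sum-mono-≤ (λ x → ≤-trans (packing S x) (*-monoʳ-≤ c (cover-⊆ {v ∷ drop 1 P₁} {P} x P₁⊆P))) ⟩
        sum (λ x → c * cover P x)
          ≡⟨ sum-*ˡ c (cover P) ⟩
        c * sum (cover P)
          ≡⟨ cong (c *_) (sym (∣p∣≡sum (⋃ (map N[_] P)))) ⟩
        c * cost P ∎)
      where
      open ≤-Reasoning
      P₁≡ : P₁ ≡ v ∷ drop 1 P₁
      P₁≡ = Walk-head p₁
      S : Shortcut t v (drop 1 P₁)
      S = shortcut (length P₁) (≤-trans (n≤1+n _) (≤-reflexive (cong length (sym P₁≡))))
            (subst (Walk t v) P₁≡ p₁) (subst Induced P₁≡ i₁)
      length≡sum : ∀ L → length L ≡ sum (copies L)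
      length≡sum L = sym (trans (sum-hits ⁅_⁆ L) (trans (total-cong ∣⁅x⁆∣≡1 L) (total-1 L)))
      P₁⊆P : ∀ {x} → x ∈ₗ v ∷ drop 1 P₁ → x ∈ₗ P
      P₁⊆P x∈ = subst (_ ∈ₗ_) (sym (Walk-head p)) (case x∈ of λ where
        (here e)   → here e
        (there z∈) → there (⊆₁ z∈))
      sum-1 : ∀ n → sum {n} (λ _ → 1) ≡ n
      sum-1 zero = refl
      sum-1 (suc n) = cong suc (sum-1 n)
      P₁≤n : length P₁ ≤ n
      P₁≤n = ≤-trans (≤-reflexive (length≡sum P₁))
        (≤-trans (sum-mono-≤ (Induced-simple p₁ i₁)) (≤-reflexive (sum-1 n)))

    -- As `c` is `3 + a`, the truncated difference is at most `a * d`; after squaring, `a * a` is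
    -- bounded by the maximum degree.
    light⇒approximate : ∀ {b d} → b ≤ c * d → a * a ≤ maxDegree → b ≤[√ maxDegree + 3 ]· d
    light⇒approximate {b} {d} b≤ a² = begin
      (b ∸ 3 * d) ^ 2         ≡⟨ cong ((b ∸ 3 * d) *_) (*-identityʳ _) ⟩
      (b ∸ 3 * d) * (b ∸ 3 * d) ≤⟨ *-mono-≤ le le ⟩
      (a * d) * (a * d)       ≡⟨ lemma a d ⟩
      a * a * (d * (d * 1))         ≤⟨ *-monoˡ-≤ (d ^ 2) a² ⟩
      maxDegree * d ^ 2       ∎
      where
      open ≤-Reasoning
      lemma : ∀ a d → (a * d) * (a * d) ≡ a * a * (d * (d * 1))
      lemma = solve-∀
      le : b ∸ 3 * d ≤ a * d
      le = m≤n+o⇒m∸n≤o b (3 * d) (≤-trans b≤ (≤-reflexive (*-distribʳ-+ d 3 a)))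

-- Bellman-Ford with vertex weights.

Entry : ℕ → Set
Entry n = Maybe (ℕ × List (Fin n))

-- Ties favour the second argument, where `update` passes the old entry. So an entry is replaced
-- only by a strictly cheaper one, which keeps the stored paths simple.
minEntry : ∀ {n} → Entry n → Entry n → Entry n
minEntry nothing        e       = e
minEntry (just x)       nothing = just x
minEntry (just (a , P)) (just (b , Q)) with a <? b
... | yes _ = just (a , P)
... | no  _ = just (b , Q)

data Minimum {n} : Entry n → Entry n → Entry n → Set where
  kept : ∀ {d e} → Minimum d e e
  taken : ∀ {c P e} → (∀ {b Q} → e ≡ just (b , Q) → c < b) → Minimum (just (c , P)) e (just (c , P))

minimum : ∀ {n} (d e : Entry n) → Minimum d e (minEntry d e)
minimum nothing        e       = kept
minimum (just x)       nothing = taken λ ()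
minimum (just (a , P)) (just (b , Q)) with a <? b
... | yes a<b = taken λ { refl → a<b }
... | no  _   = kept

module BellmanFord {n : ℕ} (G : Graph n) where

  open Graph G
  open Walks G

  -- An accumulator rather than a sum, in order to follow the loop over `degreeStep` one iteration
  -- at a time.
  pushDegree : Fin n → List (Fin n) → ℕ → ℕ
  pushDegree v []       c = c
  pushDegree v (u ∷ us) c = pushDegree v us (ifᵇ adj v u then suc c else c)

  pushDegree-weight : ∀ v c → suc (pushDegree v (allFin n) c) ≡ c + weight v
  pushDegree-weight v c =
    trans (cong suc (go′ n (λ u → u) c)) (trans (sym (+-suc c (degree v))) (cong (c +_) (sym (weight≡1+degree v))))
    where
    go′ : ∀ m (g : Fin m → Fin n) c → pushDegree v (tabulate g) c ≡ c + ∣ Vec.tabulate (adj v ∘ g) ∣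
    go′ zero    g c = sym (+-identityʳ c)
    go′ (suc m) g c with adj v (g zero)
    ... | true  = trans (go′ m (g ∘ suc) (suc c)) (sym (+-suc c _))
    ... | false = go′ m (g ∘ suc) c

  candidate : Fin n → (Fin n → Entry n) → Fin n → Entry n
  candidate v f u = ifᵇ adj v u then f u else nothing

  scan : Fin n → (Fin n → Entry n) → List (Fin n) → Entry n → Entry n
  scan v f []       e = e
  scan v f (u ∷ us) e = scan v f us (minEntry (candidate v f u) e)

  extend : Fin n → Entry n → Entry n
  extend v nothing        = nothing
  extend v (just (c , P)) = just (suc (pushDegree v (allFin n) c) , v ∷ P)

  update : (Fin n → Entry n) → Fin n → Entry n
  update f v = minEntry (extend v (scan v f (allFin n) nothing)) (f v)

  scan-origin : ∀ {v f x} us {e} → scan v f us e ≡ just x → e ≡ just x ⊎ ∃[ u ] Adjacent v u × f u ≡ just x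
  scan-origin [] h = inj₁ h
  scan-origin {v} {f} (u ∷ us) {e} h with scan-origin {v} {f} us h
  ... | inj₂ r = inj₂ r
  ... | inj₁ h′ = by (minimum (candidate v f u) e) refl h′
    where
    by : ∀ {d r x} → Minimum d e r → d ≡ candidate v f u → r ≡ just x →
         e ≡ just x ⊎ ∃[ u ] Adjacent v u × f u ≡ just x
    by kept _ r = inj₁ r
    by (taken _) d r with adj v u in a
    ... | true = inj₂ (u , a , trans (sym d) r)

  pushDegree-+ : ∀ v c {m l} → c + m ≡ l → suc (pushDegree v (allFin n) c) + m ≡ weight v + l
  pushDegree-+ v c {m} e =
    trans (cong (_+ m) (trans (pushDegree-weight v c) (+-comm c _))) (trans (+-assoc (weight v) c m) (cong (weight v +_) e))

  module _ (t : Fin n) where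

    -- Entries measure a walk without its last vertex t, whose weight is common
    -- to all walks to t.

    AtMost : Entry n → ℕ → Set
    AtMost e m = ∃[ c ] ∃[ P ] e ≡ just (c , P) × c + weight t ≤ m

    minEntry-AtMostˡ : ∀ {d m} e → AtMost d m → AtMost (minEntry d e) m
    minEntry-AtMostˡ nothing (a , P , refl , a≤) = a , P , refl , a≤
    minEntry-AtMostˡ (just (b , Q)) (a , P , refl , a≤) with a <? b
    ... | yes _ = a , P , refl , a≤
    ... | no a≮b = b , Q , refl , ≤-trans (+-monoˡ-≤ (weight t) (≮⇒≥ a≮b)) a≤

    minEntry-AtMostʳ : ∀ {e m} d → AtMost e m → AtMost (minEntry d e) m
    minEntry-AtMostʳ nothing e≤ = e≤
    minEntry-AtMostʳ (just (a , P)) (b , Q , refl , b≤) with a <? b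
    ... | yes a<b = a , P , refl , ≤-trans (+-monoˡ-≤ (weight t) (<⇒≤ a<b)) b≤
    ... | no  _   = b , Q , refl , b≤

    scan-AtMost-acc : ∀ {v f m} us {e} → AtMost e m → AtMost (scan v f us e) m
    scan-AtMost-acc []       e≤ = e≤
    scan-AtMost-acc {v} {f} (u ∷ us) e≤ = scan-AtMost-acc us (minEntry-AtMostʳ (candidate v f u) e≤)

    scan-AtMost : ∀ {v f m u us e} → u ∈ₗ us → Adjacent v u → AtMost (f u) m → AtMost (scan v f us e) m
    scan-AtMost {v} {f} {u = u} {us = _ ∷ us} {e} (here refl) a fu≤ =
      scan-AtMost-acc us (minEntry-AtMostˡ e (subst (λ b → AtMost (ifᵇ b then f u else nothing) _) (sym a) fu≤))
    scan-AtMost (there u∈) a fu≤ = scan-AtMost u∈ a fu≤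

    record Sound (k : ℕ) (v : Fin n) (e : Entry n) : Set where
      constructor sound
      field
        path : ∀ {c P} → e ≡ just (c , P) → Walk t v P × c + weight t ≡ W P × Unique P × length P ≤ suc k

    Complete : ℕ → (Fin n → Entry n) → Set
    Complete k f = ∀ {v Q} → Walk t v Q → length Q ≤ suc k → AtMost (f v) (W Q)

    initial : Fin n → Entry n
    initial v with v ≟ t
    ... | yes _ = just (0 , t ∷ [])
    ... | no  _ = nothing

    table : ℕ → Fin n → Entry n
    table zero    = initial
    table (suc k) = update (table k)

    initial-sound : ∀ v → Sound 0 v (initial v)
    initial-sound v with v ≟ t
    ... | yes refl = sound λ { refl → stop , sym (+-identityʳ _) , [] ∷ [] , ≤-refl }
    ... | no  _    = sound λ ()

    initial-complete : Complete 0 initial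
    initial-complete stop _ with t ≟ t
    ... | yes _ = 0 , t ∷ [] , refl , m≤m+n _ _
    ... | no ≢ = contradiction refl ≢
    initial-complete (go _ p) (s≤s l) =
      contradiction (≤-trans (≤-reflexive (sym (cong length (Walk-head p)))) l) λ ()

    W-suffix : ∀ xs {ys} → W ys ≤ W (xs ++ ys)
    W-suffix xs {ys} = ≤-trans (m≤n+m (W ys) (W xs)) (≤-reflexive (sym (total-++ weight xs ys)))

    -- Completeness of the old table serves to show simplicity: it bounds the old entry of `v` by
    -- any walk from `v` contained in the new path, while `taken` makes the new entry strictly
    -- cheaper than the old one.
    update-sound : ∀ {k f} → (∀ v → Sound k v (f v)) → Complete k f → ∀ v → Sound (suc k) v (update f v)
    update-sound {k} {f} s cmp v = sound (by (minimum (extend v best) (f v)) refl)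
      where
      best = scan v f (allFin n) nothing
      by : ∀ {d r c P} → Minimum d (f v) r → d ≡ extend v best → r ≡ just (c , P) →
           Walk t v P × c + weight t ≡ W P × Unique P × length P ≤ suc (suc k)
      by kept _ r with Sound.path (s v) r
      ... | p , e , u , l = p , e , u , m≤n⇒m≤1+n l
      by (taken c<) d refl with best in origin
      by (taken c<) refl refl | just (c , P) with scan-origin (allFin n) origin
      ... | inj₂ (u , a , fu) with Sound.path (s u) fu
      ...   | p , e , uniq , l = go a p , total-weight , All.¬Any⇒All¬ P fresh ∷ uniq , s≤s l
        where
        total-weight : suc (pushDegree v (allFin n) c) + weight t ≡ weight v + W P
        total-weight = pushDegree-+ v c e
        -- Otherwise the part of P from v on would beat the new entry for v.
        fresh : ¬ (v ∈ₗ P)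
        fresh v∈ with ∈-∃++ v∈
        ... | xs , ys , refl with cmp (Walk-suffix xs p) (≤-trans (length-suffix xs (v ∷ ys)) l)
        ...   | b , _ , fv , b≤ = <⇒≱ (c< fv)
          (≤-trans (+-cancelʳ-≤ (weight t) b c (≤-trans b≤ (≤-trans (W-suffix xs) (≤-reflexive (sym e)))))
                   (≤-trans (m≤m+n c (weight v)) (≤-reflexive (sym (pushDegree-weight v c)))))

    update-complete : ∀ {k f} → Complete k f → Complete (suc k) (update f)
    update-complete {f = f} cmp {v} stop l =
      minEntry-AtMostʳ (extend v (scan v f (allFin n) nothing)) (cmp stop (s≤s z≤n))
    update-complete {f = f} cmp {v} (go {u = u} {P} a p) (s≤s l) =
      minEntry-AtMostˡ (f v) (extend-AtMost (scan-AtMost (∈-allFin u) a (cmp p l)))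
      where
      extend-AtMost : ∀ {e} → AtMost e (W P) → AtMost (extend v e) (weight v + W P)
      extend-AtMost (c , P , refl , c≤) =
        _ , _ , refl , ≤-trans (≤-reflexive (pushDegree-+ v c refl)) (+-monoʳ-≤ (weight v) c≤)

    table-complete : ∀ k → Complete k (table k)
    table-complete zero    = initial-complete
    table-complete (suc k) = update-complete (table-complete k)

    table-sound : ∀ k v → Sound k v (table k v)
    table-sound zero    = initial-sound
    table-sound (suc k) = update-sound (table-sound k) (table-complete k)

    Bounded : ℕ → Entry n → Set
    Bounded B e = ∀ {c P} → e ≡ just (c , P) → c ≤ B

    -- The program holds costs in unary and compares them by a loop; this bounds the number of its
    -- iterations.
    table-bounded : ∀ k v → Bounded (suc k * n) (table k v)
    table-bounded k v {c} {P} e with Sound.path (table-sound k v) e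
    ... | _ , eq , _ , l = ≤-trans (≤-trans (m≤m+n c (weight t)) (≤-reflexive eq)) (≤-trans (W≤ P) (*-monoˡ-≤ n l))
      where
      W≤ : ∀ P → W P ≤ length P * n
      W≤ []      = z≤n
      W≤ (v ∷ P) = +-mono-≤ (∣p∣≤n N[ v ]) (W≤ P)

    extend-bounded : ∀ k v → Bounded (suc (suc k) * n) (extend v (scan v (table k) (allFin n) nothing))
    extend-bounded k v h with scan v (table k) (allFin n) nothing in origin
    extend-bounded k v refl | just (c , P) with scan-origin (allFin n) origin
    ... | inj₂ (u , a , fu) =
      ≤-trans (≤-reflexive (trans (pushDegree-weight v c) (+-comm c _))) (+-mono-≤ (∣p∣≤n N[ v ]) (table-bounded k u fu))

    Linked⇒Walk : ∀ {s} P → head P ≡ just s → lastElement P ≡ just t → Linked Adjacent P → Walk t s P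
    Linked⇒Walk (_ ∷ [])    refl refl _       = stop
    Linked⇒Walk (_ ∷ _ ∷ P) refl e    (a ∷ l) = go a (Linked⇒Walk (_ ∷ P) refl e l)

    Walk⇒Linked : ∀ {s P} → Walk t s P → Linked Adjacent P
    Walk⇒Linked stop = [-]
    Walk⇒Linked (go a stop) = a ∷ [-]
    Walk⇒Linked (go a p@(go _ _)) = a ∷ Walk⇒Linked p

    Walk-last : ∀ {s P} → Walk t s P → lastElement P ≡ just t
    Walk-last stop = refl
    Walk-last (go a stop) = refl
    Walk-last (go a p@(go _ _)) = Walk-last p

    -- The light walk obtained from the given path shows that `s` has an entry after `n` rounds. The
    -- one obtained from any `P*` then bounds this same entry, and the cost of the stored path is at
    -- most its weight.
    table-approximates : ∀ {s} → ∃ (IsPath s t) →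
                         ∃[ c ] ∃[ P ] table n s ≡ just (c , P) × IsPath s t P ×
                           (∀ P* → IsPath s t P* → cost P ≤[√ maxDegree + 3 ]· cost P*)
    table-approximates {s} (P₀ , path₀) with ∃√ maxDegree
    ... | a , a²≤ , ≤a²+2a with light-walk a ≤a²+2a (toWalk path₀)
      where
      toWalk : ∀ {P} → IsPath s t P → Walk t s P
      toWalk {P} p = Linked⇒Walk P (IsPath.starts p) (IsPath.ends p) (IsPath.linked p)
    ... | Q₀ , q₀ , l₀ , _ with table-complete n q₀ (m≤n⇒m≤1+n l₀)
    ...   | c , P , e , _ with Sound.path (table-sound n s) e
    ...     | p , W≡ , uniq , _ = c , P , e , path , approx
      where
      path : IsPath s t P
      path = record
        { starts = cong head (Walk-head p) ; ends = Walk-last p ; linked = Walk⇒Linked p ; simple = uniq }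
      approx : ∀ P* → IsPath s t P* → cost P ≤[√ maxDegree + 3 ]· cost P*
      approx P* p* with light-walk a ≤a²+2a (Linked⇒Walk P* (IsPath.starts p*) (IsPath.ends p*) (IsPath.linked p*))
      ... | Q , q , l , light with table-complete n q (m≤n⇒m≤1+n l)
      ...   | c′ , P′ , e′ , c′≤ with trans (sym e) e′
      ...     | refl = light⇒approximate a ≤a²+2a {cost P} {cost P*}
                         (≤-trans (∣⋃∣≤total N[_] P)
                           (≤-trans (≤-reflexive (sym W≡)) (≤-trans c′≤ light))) a²≤

-- Running times of WHILE programs.

-- The time needed if no loop is iterated more than K times.

maxTime : ∀ {k} → ℕ → Com k → ℕ
maxTime K (x := e)             = 1 + expTime e
maxTime K (C ⨾ D)              = maxTime K C + maxTime K D
maxTime K (if e then C else D) = 1 + expTime e + (maxTime K C + maxTime K D)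
maxTime K (while e loop C)     = (1 + expTime e) + K * (1 + expTime e + maxTime K C)

-- Zero is excluded because `N ^ d` is monotone in `d` only for positive `N`, and `poly-+` raises
-- exponents.
IsPolynomial : (ℕ → ℕ) → Set
IsPolynomial f = ∃[ c ] ∃[ d ] ∀ N .{{_ : NonZero N}} → f N ≤ c * N ^ d

poly-const : ∀ a → IsPolynomial (λ _ → a)
poly-const a = a , 0 , λ N → ≤-reflexive (sym (*-identityʳ a))

poly-id : IsPolynomial (λ N → N)
poly-id = 1 , 1 , λ N → ≤-reflexive (sym (trans (*-identityˡ _) (*-identityʳ N)))

poly-+ : ∀ {f g} → IsPolynomial f → IsPolynomial g → IsPolynomial (λ N → f N + g N)
poly-+ (c , d , f≤) (c′ , d′ , g≤) = c + c′ , d + d′ , λ N →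
  ≤-trans (+-mono-≤ (≤-trans (f≤ N) (*-monoʳ-≤ c (^-monoʳ-≤ N (m≤m+n d d′))))
                    (≤-trans (g≤ N) (*-monoʳ-≤ c′ (^-monoʳ-≤ N (m≤n+m d′ d)))))
          (≤-reflexive (sym (*-distribʳ-+ (N ^ (d + d′)) c c′)))

poly-* : ∀ {f g} → IsPolynomial f → IsPolynomial g → IsPolynomial (λ N → f N * g N)
poly-* (c , d , f≤) (c′ , d′ , g≤) = c * c′ , d + d′ , λ N →
  ≤-trans (*-mono-≤ (f≤ N) (g≤ N))
          (≤-reflexive (trans (lemma c (N ^ d) c′ (N ^ d′)) (cong (c * c′ *_) (sym (^-distribˡ-+-* N d d′)))))
  where
  lemma : ∀ a x b y → (a * x) * (b * y) ≡ (a * b) * (x * y)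
  lemma = solve-∀

-- The command is fixed, so its nested loops multiply `K N` into the bound only a fixed number of
-- times.
poly-maxTime : ∀ {k K} (C : Com k) → IsPolynomial K → IsPolynomial (λ N → maxTime (K N) C)
poly-maxTime (x := e)             p = poly-const _
poly-maxTime (C ⨾ D)              p = poly-+ (poly-maxTime C p) (poly-maxTime D p)
poly-maxTime (if e then C else D) p =
  poly-+ (poly-const (1 + expTime e)) (poly-+ (poly-maxTime C p) (poly-maxTime D p))
poly-maxTime (while e loop C)     p =
  poly-+ (poly-const (1 + expTime e)) (poly-* p (poly-+ (poly-const (1 + expTime e)) (poly-maxTime C p)))

module Execution (K : ℕ) {k : ℕ} where

  record Run (C : Com k) (σ σ′ : Store k) : Set where
    constructor run
    field
      {time}   : ℕ
      executes : ⟨ C , σ ⟩⇓ σ′ # time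
      bounded  : time ≤ maxTime K C

  -- `j` counts iterations while a loop is unfolded; only `whileᴿ` weakens it to `K`.
  record Iterate (e : Exp k) (C : Com k) (σ σ′ : Store k) (j : ℕ) : Set where
    constructor iterate
    field
      {time}   : ℕ
      executes : ⟨ while e loop C , σ ⟩⇓ σ′ # time
      bounded  : time ≤ (1 + expTime e) + j * (1 + expTime e + maxTime K C)

  infixr 5 _⨾ᴿ_

  assignᴿ : ∀ {x e σ} → Run (x := e) σ (σ [ x ]≔ eval e σ)
  assignᴿ = run assign ≤-refl

  _⨾ᴿ_ : ∀ {C D σ σ′ σ″} → Run C σ σ′ → Run D σ′ σ″ → Run (C ⨾ D) σ σ″
  run c c≤ ⨾ᴿ run d d≤ = run (seq c d) (+-mono-≤ c≤ d≤)

  thenᴿ : ∀ {e C D σ σ′ a b} → eval e σ ≡ a ∙ b → Run C σ σ′ → Run (if e then C else D) σ σ′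
  thenᴿ {e} h (run c c≤) = run (if-t h c) (+-monoʳ-≤ (1 + expTime e) (≤-trans c≤ (m≤m+n _ _)))

  elseᴿ : ∀ {e C D σ σ′} → eval e σ ≡ nil → Run D σ σ′ → Run (if e then C else D) σ σ′
  elseᴿ {e} {C} h (run d d≤) = run (if-f h d) (+-monoʳ-≤ (1 + expTime e) (≤-trans d≤ (m≤n+m _ (maxTime K C))))

  doneᴿ : ∀ {e C σ} → eval e σ ≡ nil → Iterate e C σ σ 0
  doneᴿ h = iterate (done h) (m≤m+n _ _)

  againᴿ : ∀ {e C σ σ′ σ″ a b j} → eval e σ ≡ a ∙ b → Run C σ σ′ → Iterate e C σ′ σ″ j → Iterate e C σ σ″ (suc j)
  againᴿ {e} {C} {j = j} h (run {m} c c≤) (iterate {m′} w w≤) = iterate (loop h c w)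
    (≤-trans (+-mono-≤ (+-monoʳ-≤ (1 + expTime e) c≤) w≤)
      (≤-reflexive (lemma (1 + expTime e) (maxTime K C) (j * (1 + expTime e + maxTime K C)))))
    where
    lemma : ∀ a b c → (a + b) + (a + c) ≡ a + ((a + b) + c)
    lemma = solve-∀

  whileᴿ : ∀ {e C σ σ′ j} → Iterate e C σ σ′ j → j ≤ K → Run (while e loop C) σ σ′
  whileᴿ {e} {C} (iterate w w≤) j≤K =
    run w (≤-trans w≤ (+-monoʳ-≤ (1 + expTime e) (*-monoˡ-≤ (1 + expTime e + maxTime K C) j≤K)))

-- The WHILE program.

inputᵛ graphᵛ sourceᵛ tableᵛ roundsᵛ rowsᵛ vertexᵛ oldᵛ : Fin 16
newᵛ rowᵛ entriesᵛ candᵛ bestᵛ aᵛ bᵛ costᵛ : Fin 16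
inputᵛ   = # 0
graphᵛ   = # 1
sourceᵛ  = # 2
tableᵛ   = # 3
roundsᵛ  = # 4
rowsᵛ    = # 5
vertexᵛ  = # 6
oldᵛ     = # 7
newᵛ     = # 8
rowᵛ     = # 9
entriesᵛ = # 10
candᵛ    = # 11
bestᵛ    = # 12
aᵛ       = # 13
bᵛ       = # 14
costᵛ    = # 15

-- Every command resets its auxiliary variables to nil, so that they need not be
-- tracked between commands. In particular aᵛ := nil does nothing and serves as
-- an empty branch.

-- The loop computes b ∸ a in bᵛ, as tl nil = nil; so bᵛ ends up different from
-- nil iff a < b. A missing entry in bestᵛ counts as worse than any candidate.

minimise : Com 16
minimise =
  if var candᵛ then
    aᵛ := hd (var candᵛ) ⨾
    if var bestᵛ then bᵛ := hd (var bestᵛ) else bᵛ := cons nil (var aᵛ) ⨾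
    while var aᵛ loop (aᵛ := tl (var aᵛ) ⨾ bᵛ := tl (var bᵛ)) ⨾
    if var bᵛ then bestᵛ := var candᵛ else aᵛ := nil ⨾
    bᵛ := nil ⨾
    candᵛ := nil
  else aᵛ := nil

scanStep : Com 16
scanStep =
  if hd (var rowᵛ) then candᵛ := hd (var entriesᵛ) else candᵛ := nil ⨾
  minimise ⨾
  rowᵛ := tl (var rowᵛ) ⨾
  entriesᵛ := tl (var entriesᵛ)

degreeStep : Com 16
degreeStep =
  if hd (var rowᵛ) then costᵛ := cons nil (var costᵛ) else aᵛ := nil ⨾
  rowᵛ := tl (var rowᵛ)

-- The loop adds the degree of the current vertex to the cost, and the additional `nil` accounts for
-- the vertex itself, so its weight is added in total.
extendBest : Com 16
extendBest =
  if var bestᵛ then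
    costᵛ := hd (var bestᵛ) ⨾
    rowᵛ := hd (var rowsᵛ) ⨾
    while var rowᵛ loop degreeStep ⨾
    candᵛ := cons (cons nil (var costᵛ)) (cons (var vertexᵛ) (tl (var bestᵛ))) ⨾
    costᵛ := nil
  else aᵛ := nil

-- `tableᵛ` stays intact, since every vertex scans the whole old table; `oldᵛ` is a second pointer
-- into it that moves along with the current vertex, whose unary name is in `vertexᵛ`.
updateVertex : Com 16
updateVertex =
  rowᵛ := hd (var rowsᵛ) ⨾
  entriesᵛ := var tableᵛ ⨾
  while var rowᵛ loop scanStep ⨾
  entriesᵛ := nil ⨾
  extendBest ⨾
  bestᵛ := hd (var oldᵛ) ⨾
  minimise ⨾
  newᵛ := cons (var bestᵛ) (var newᵛ) ⨾
  bestᵛ := nil ⨾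
  oldᵛ := tl (var oldᵛ) ⨾
  vertexᵛ := cons nil (var vertexᵛ) ⨾
  rowsᵛ := tl (var rowsᵛ)

-- The new table is collected in reverse order, hence the second loop.

updateTable : Com 16
updateTable =
  rowsᵛ := var graphᵛ ⨾
  oldᵛ := var tableᵛ ⨾
  while var rowsᵛ loop updateVertex ⨾
  vertexᵛ := nil ⨾
  oldᵛ := nil ⨾
  tableᵛ := nil ⨾
  while var newᵛ loop (tableᵛ := cons (hd (var newᵛ)) (var tableᵛ) ⨾ newᵛ := tl (var newᵛ))

approximate : Com 16
approximate =
  graphᵛ := hd (var inputᵛ) ⨾
  sourceᵛ := hd (tl (var inputᵛ)) ⨾
  aᵛ := tl (tl (var inputᵛ)) ⨾
  -- The target gets cost 0 and the one-vertex path. The next loop prepends a `nil` for each smaller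
  -- vertex; larger vertices lie beyond the end of the list and read as `nil`.
  tableᵛ := cons (cons nil (cons (var aᵛ) nil)) nil ⨾
  while var aᵛ loop (tableᵛ := cons nil (var tableᵛ) ⨾ aᵛ := tl (var aᵛ)) ⨾
  -- The adjacency matrix has `n` rows, so it serves as a unary counter for `n` rounds.
  roundsᵛ := var graphᵛ ⨾
  while var roundsᵛ loop (updateTable ⨾ roundsᵛ := tl (var roundsᵛ)) ⨾
  while var sourceᵛ loop (tableᵛ := tl (var tableᵛ) ⨾ sourceᵛ := tl (var sourceᵛ)) ⨾
  inputᵛ := tl (hd (var tableᵛ))

-- Encodings and correctness of the program.

unary : ℕ → Tree
unary m = encodeList (replicate m nil)

encodeEntry : ∀ {n} → Entry n → Tree
encodeEntry nothing        = nil
encodeEntry (just (m , P)) = unary m ∙ encodePath P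

-- With `tlᵗ` outside, one loop iteration takes `drops k T` to `drops (suc k) T` by definition.
drops : ℕ → Tree → Tree
drops zero    T = T
drops (suc k) T = tlᵗ (drops k T)

drops-tl : ∀ k T → drops k (tlᵗ T) ≡ drops (suc k) T
drops-tl zero    T = refl
drops-tl (suc k) T = cong tlᵗ (drops-tl k T)

-- Only the cells that are read are constrained, not the length of `T`, because the initial table
-- stops after the entry of `t`.
Tabulates : ∀ {n} → Tree → (Fin n → Entry n) → Set
Tabulates T f = ∀ u → hdᵗ (drops (toℕ u) T) ≡ encodeEntry (f u)

hd-drops-tabulate : ∀ {m} (h : Fin m → Tree) u → hdᵗ (drops (toℕ u) (encodeList (tabulate h))) ≡ h u
hd-drops-tabulate {suc m} h zero    = refl
hd-drops-tabulate {suc m} h (suc u) = trans (cong hdᵗ (sym (drops-tl (toℕ u) _))) (hd-drops-tabulate (h ∘ suc) u)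

-- Loops are verified by induction over suffixes of `allFin n`; this ties the head of a suffix to
-- the number of cells dropped so far.
Counts : ∀ {n} → ℕ → List (Fin n) → Set
Counts k []       = ⊤
Counts k (v ∷ vs) = toℕ v ≡ k × Counts (suc k) vs

Counts-tabulate : ∀ {n m} k (f : Fin m → Fin n) → (∀ i → toℕ (f i) ≡ k + toℕ i) → Counts k (tabulate f)
Counts-tabulate {m = zero}  k f h = tt
Counts-tabulate {m = suc m} k f h =
  trans (h zero) (+-identityʳ k) , Counts-tabulate (suc k) (f ∘ suc) (λ i → trans (h (suc i)) (+-suc k (toℕ i)))

Counts-allFin : ∀ n → Counts 0 (allFin n)
Counts-allFin n = Counts-tabulate 0 (λ i → i) (λ _ → refl)

-- Within `n` rounds every candidate has at most `2 + n` vertices, each of weight at most `n`. So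
-- `K` bounds the unary subtractions, and also the loops over vertices.
module Correctness {n : ℕ} (G : Graph n) (t : Fin n) (K : ℕ) ([2+n]*n≤K : (2 + n) * n ≤ K) where

  open Graph G using (adj)
  open BellmanFord G
  open Execution K

  store : (io g s D cnt rows vtx old E row d cand best a b c : Tree) → Store 16
  store io g s D cnt rows vtx old E row d cand best a b c =
    io ∷ g ∷ s ∷ D ∷ cnt ∷ rows ∷ vtx ∷ old ∷ E ∷ row ∷ d ∷ cand ∷ best ∷ a ∷ b ∷ c ∷ []
    where open Vec

  module _ {io g s D cnt rows vtx old E row d : Tree} where

    runs-subtract : ∀ {x y z m} i j → j ∸ i ≡ m →
      Iterate (var aᵛ) (aᵛ := tl (var aᵛ) ⨾ bᵛ := tl (var bᵛ))
        (store io g s D cnt rows vtx old E row d x y (unary i) (unary j) z)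
        (store io g s D cnt rows vtx old E row d x y nil (unary m) z) i
    runs-subtract zero    j       refl = doneᴿ refl
    runs-subtract (suc i) zero    refl = againᴿ refl (assignᴿ ⨾ᴿ assignᴿ) (runs-subtract i 0 (0∸n≡0 i))
    runs-subtract (suc i) (suc j) e    = againᴿ refl (assignᴿ ⨾ᴿ assignᴿ) (runs-subtract i j e)

    runs-minimise : ∀ {z} (e₁ e₂ : Entry n) → Bounded t K e₁ →
      Run minimise (store io g s D cnt rows vtx old E row d (encodeEntry e₁) (encodeEntry e₂) nil nil z)
                   (store io g s D cnt rows vtx old E row d nil (encodeEntry (minEntry e₁ e₂)) nil nil z)
    runs-minimise nothing e₂ _ = elseᴿ refl assignᴿ
    runs-minimise (just (i , P)) nothing i≤ =
      thenᴿ refl (assignᴿ ⨾ᴿ elseᴿ refl assignᴿ ⨾ᴿ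
        whileᴿ (runs-subtract i (suc i) (m+n∸n≡m 1 i)) (i≤ refl) ⨾ᴿ
        thenᴿ refl assignᴿ ⨾ᴿ assignᴿ ⨾ᴿ assignᴿ)
    runs-minimise (just (i , P)) (just (j , Q)) i≤ =
      thenᴿ refl (assignᴿ ⨾ᴿ thenᴿ refl assignᴿ ⨾ᴿ
        whileᴿ (runs-subtract i j refl) (i≤ refl) ⨾ᴿ
        select ⨾ᴿ assignᴿ ⨾ᴿ assignᴿ)
      where
      select : ∀ {z} → Run (if var bᵛ then bestᵛ := var candᵛ else aᵛ := nil)
        (store io g s D cnt rows vtx old E row d (encodeEntry (just (i , P)))
           (encodeEntry (just (j , Q))) nil (unary (j ∸ i)) z)
        (store io g s D cnt rows vtx old E row d (encodeEntry (just (i , P)))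
           (encodeEntry (minEntry (just (i , P)) (just (j , Q)))) nil (unary (j ∸ i)) z)
      select with i <? j
      ... | yes i<j = thenᴿ (cong unary (sym (m+[n∸m]≡n (m<n⇒0<n∸m i<j)))) assignᴿ
      ... | no  i≮j = elseᴿ (cong unary (m≤n⇒m∸n≡0 (≮⇒≥ i≮j))) assignᴿ

  encodeRow : Fin n → List (Fin n) → Tree
  encodeRow v us = encodeList (map (λ u → encodeBool (adj v u)) us)

  encodeRows : List (Fin n) → Tree
  encodeRows vs = encodeList (map (λ v → encodeRow v (allFin n)) vs)

  -- `advance` and `grow` name what a loop leaves in `entriesᵛ` and `oldᵛ`, and in `vertexᵛ`. These
  -- leftovers are then overwritten by `nil`, so nothing has to be proved about them.
  advance : List (Fin n) → Tree → Tree
  advance []       T = T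
  advance (_ ∷ vs) T = advance vs (tlᵗ T)

  grow : List (Fin n) → Tree → Tree
  grow []       T = T
  grow (_ ∷ vs) T = grow vs (nil ∙ T)

  length-allFin≤K : length (allFin n) ≤ K
  length-allFin≤K = ≤-trans (≤-reflexive (length-tabulate {n = n} (λ i → i))) (≤-trans (m≤m+n n _) [2+n]*n≤K)

  module _ {io g s D cnt rows vtx old E : Tree} where

    runs-candidate : ∀ {r T y z} β (e : Entry n) → hdᵗ T ≡ encodeEntry e →
      Run (if hd (var rowᵛ) then candᵛ := hd (var entriesᵛ) else candᵛ := nil)
        (store io g s D cnt rows vtx old E (encodeBool β ∙ r) T nil y nil nil z)
        (store io g s D cnt rows vtx old E (encodeBool β ∙ r) T (encodeEntry (ifᵇ β then e else nothing)) y nil nil z)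
    runs-candidate false e h = elseᴿ refl assignᴿ
    runs-candidate {r} {T} {y} {z} true  e h =
      subst (λ x → Run _ (store io g s D cnt rows vtx old E (encodeBool true ∙ r) T nil y nil nil z)
                         (store io g s D cnt rows vtx old E (encodeBool true ∙ r) T x y nil nil z)) h
            (thenᴿ refl assignᴿ)

    runs-scan : ∀ {T f v z} us {k e} → Tabulates T f → (∀ u → Bounded t K (f u)) → Counts k us →
      Iterate (var rowᵛ) scanStep
        (store io g s D cnt rows vtx old E (encodeRow v us) (drops k T) nil (encodeEntry e) nil nil z)
        (store io g s D cnt rows vtx old E nil (advance us (drops k T)) nil (encodeEntry (scan v f us e)) nil nil z)
        (length us)
    runs-scan []       T≈f f≤ _ = doneᴿ refl
    runs-scan {T} {f} {v} (u ∷ us) {k} {e} T≈f f≤ (refl , cs) =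
      againᴿ refl (runs-candidate (adj v u) (f u) (T≈f u) ⨾ᴿ
              runs-minimise (candidate v f u) e candidate≤ ⨾ᴿ assignᴿ ⨾ᴿ assignᴿ)
        (runs-scan us T≈f f≤ cs)
      where
      candidate≤ : Bounded t K (candidate v f u)
      candidate≤ with adj v u
      ... | true  = f≤ u
      ... | false = λ ()

    runs-increment : ∀ {r d x y} β m →
      Run (if hd (var rowᵛ) then costᵛ := cons nil (var costᵛ) else aᵛ := nil)
        (store io g s D cnt rows vtx old E (encodeBool β ∙ r) d x y nil nil (unary m))
        (store io g s D cnt rows vtx old E (encodeBool β ∙ r) d x y nil nil (unary (ifᵇ β then suc m else m)))
    runs-increment false m = elseᴿ refl assignᴿ
    runs-increment true  m = thenᴿ refl assignᴿ

    runs-addDegree : ∀ {d x y v} us {m} →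
      Iterate (var rowᵛ) degreeStep
        (store io g s D cnt rows vtx old E (encodeRow v us) d x y nil nil (unary m))
        (store io g s D cnt rows vtx old E nil d x y nil nil (unary (pushDegree v us m)))
        (length us)
    runs-addDegree [] = doneᴿ refl
    runs-addDegree {v = v} (u ∷ us) {m} = againᴿ refl (runs-increment (adj v u) m ⨾ᴿ assignᴿ) (runs-addDegree us)

  module _ {io g s D cnt E old rows : Tree} where

    runs-extend : ∀ {v} (e : Entry n) →
      Run extendBest
        (store io g s D cnt (encodeRow v (allFin n) ∙ rows) (encodeVertex v) old E
           nil nil nil (encodeEntry e) nil nil nil)
        (store io g s D cnt (encodeRow v (allFin n) ∙ rows) (encodeVertex v) old E
           nil nil (encodeEntry (extend v e)) (encodeEntry e) nil nil nil)
    runs-extend nothing        = elseᴿ refl assignᴿ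
    runs-extend (just (m , P)) =
      thenᴿ refl (assignᴿ ⨾ᴿ assignᴿ ⨾ᴿ whileᴿ (runs-addDegree (allFin n)) length-allFin≤K ⨾ᴿ assignᴿ ⨾ᴿ assignᴿ)

  runs-updateVertex : ∀ {io g s T cnt rows old E f} v → Tabulates T f → (∀ u → Bounded t K (f u)) →
    Bounded t K (extend v (scan v f (allFin n) nothing)) → hdᵗ old ≡ encodeEntry (f v) →
    Run updateVertex
      (store io g s T cnt (encodeRow v (allFin n) ∙ rows) (encodeVertex v) old E
         nil nil nil nil nil nil nil)
      (store io g s T cnt rows (nil ∙ encodeVertex v) (tlᵗ old) (encodeEntry (update f v) ∙ E)
         nil nil nil nil nil nil nil)
  runs-updateVertex {io} {g} {s} {T} {cnt} {rows} {old} {E} {f} v T≈f f≤ x≤ h =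
    assignᴿ ⨾ᴿ assignᴿ ⨾ᴿ
    whileᴿ (runs-scan {f = f} {v} (allFin n) {0} {nothing} T≈f f≤ (Counts-allFin n)) length-allFin≤K ⨾ᴿ
    assignᴿ ⨾ᴿ runs-extend (scan v f (allFin n) nothing) ⨾ᴿ
    subst (λ y → Run (bestᵛ := hd (var oldᵛ))
      (store io g s T cnt (encodeRow v (allFin n) ∙ rows) (encodeVertex v) old E
         nil nil x (encodeEntry (scan v f (allFin n) nothing)) nil nil nil)
      (store io g s T cnt (encodeRow v (allFin n) ∙ rows) (encodeVertex v) old E
         nil nil x y nil nil nil)) h assignᴿ ⨾ᴿ
    runs-minimise (extend v (scan v f (allFin n) nothing)) (f v) x≤ ⨾ᴿ
    assignᴿ ⨾ᴿ assignᴿ ⨾ᴿ assignᴿ ⨾ᴿ assignᴿ ⨾ᴿ assignᴿ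
    where
    x = encodeEntry (extend v (scan v f (allFin n) nothing))

  runs-updateVertices : ∀ {io g s T cnt f} vs {k acc} → Tabulates T f → (∀ u → Bounded t K (f u)) →
    (∀ v → Bounded t K (extend v (scan v f (allFin n) nothing))) → Counts k vs →
    Iterate (var rowsᵛ) updateVertex
      (store io g s T cnt (encodeRows vs) (unary k) (drops k T) (encodeList acc) nil nil nil nil nil nil nil)
      (store io g s T cnt nil (grow vs (unary k)) (advance vs (drops k T))
         (encodeList (map (encodeEntry ∘ update f) vs ʳ++ acc)) nil nil nil nil nil nil nil)
      (length vs)
  runs-updateVertices []       _   _  _  _ = doneᴿ refl
  runs-updateVertices {f = f} (v ∷ vs) {acc = acc} T≈f f≤ x≤ (refl , cs) =
    againᴿ refl (runs-updateVertex v T≈f f≤ (x≤ v) (T≈f v))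
      (runs-updateVertices vs {acc = encodeEntry (update f v) ∷ acc} T≈f f≤ x≤ cs)

  runs-reverse : ∀ {io g s cnt} ts us →
    Iterate (var newᵛ) (tableᵛ := cons (hd (var newᵛ)) (var tableᵛ) ⨾ newᵛ := tl (var newᵛ))
      (store io g s (encodeList us) cnt nil nil nil (encodeList ts) nil nil nil nil nil nil nil)
      (store io g s (encodeList (ts ʳ++ us)) cnt nil nil nil nil nil nil nil nil nil nil nil)
      (length ts)
  runs-reverse []       us = doneᴿ refl
  runs-reverse (x ∷ ts) us = againᴿ refl (assignᴿ ⨾ᴿ assignᴿ) (runs-reverse ts (x ∷ us))

  runs-updateTable : ∀ {io s T cnt f} → Tabulates T f → (∀ u → Bounded t K (f u)) →
    (∀ v → Bounded t K (extend v (scan v f (allFin n) nothing))) →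
    Run updateTable
      (store io (encodeGraph G) s T cnt nil nil nil nil nil nil nil nil nil nil nil)
      (store io (encodeGraph G) s (encodeList (map (encodeEntry ∘ update f) (allFin n))) cnt
         nil nil nil nil nil nil nil nil nil nil nil)
  runs-updateTable {io} {s} {T} {cnt} {f} T≈f f≤ x≤ =
    subst (λ us → Run updateTable
        (store io (encodeGraph G) s T cnt nil nil nil nil nil nil nil nil nil nil nil)
        (store io (encodeGraph G) s (encodeList us) cnt nil nil nil nil nil nil nil nil nil nil nil))
      (reverse-involutive ts)
      (assignᴿ ⨾ᴿ assignᴿ ⨾ᴿ
       whileᴿ (runs-updateVertices (allFin n) {0} {[]} T≈f f≤ x≤ (Counts-allFin n)) length-allFin≤K ⨾ᴿ
       assignᴿ ⨾ᴿ assignᴿ ⨾ᴿ assignᴿ ⨾ᴿ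
       whileᴿ (runs-reverse (reverse ts) [])
         (≤-trans (≤-reflexive (trans (length-reverse ts) (length-map (encodeEntry ∘ update f) (allFin n))))
                   length-allFin≤K))
    where
    ts = map (encodeEntry ∘ update f) (allFin n)

  bounded-≤ : ∀ {B e} → B ≤ K → Bounded t B e → Bounded t K e
  bounded-≤ B≤K h e = ≤-trans (h e) B≤K

  -- `vs` only counts the rounds left. As `k + length vs` never exceeds `n`, the costs arising after
  -- `k` rounds stay within `K`.
  runs-rounds : ∀ {io s} vs k {T} → Tabulates T (table t k) → k + length vs ≤ n →
    ∃[ T′ ] Tabulates T′ (table t (k + length vs)) ×
      Iterate (var roundsᵛ) (updateTable ⨾ roundsᵛ := tl (var roundsᵛ))
        (store io (encodeGraph G) s T (encodeRows vs) nil nil nil nil nil nil nil nil nil nil nil)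
        (store io (encodeGraph G) s T′ nil nil nil nil nil nil nil nil nil nil nil nil)
        (length vs)
  runs-rounds [] k {T} T≈ _ = T , subst (λ k → Tabulates T (table t k)) (sym (+-identityʳ k)) T≈ , doneᴿ refl
  runs-rounds {io} {s} (v ∷ vs) k {T} T≈ k≤
    with runs-rounds {io} {s} vs (suc k) T₁≈ (≤-trans (≤-reflexive (sym (+-suc k (length vs)))) k≤)
    where
    T₁≈ : Tabulates (encodeList (map (encodeEntry ∘ table t (suc k)) (allFin n))) (table t (suc k))
    T₁≈ u = trans (cong (λ l → hdᵗ (drops (toℕ u) (encodeList l)))
                        (map-tabulate (λ i → i) (encodeEntry ∘ table t (suc k))))
                  (hd-drops-tabulate (encodeEntry ∘ table t (suc k)) u)
  ... | T′ , T′≈ , runs = T′ , subst (λ k → Tabulates T′ (table t k)) (sym (+-suc k (length vs))) T′≈ ,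
        againᴿ refl (runs-updateTable T≈
          (λ u → bounded-≤ (≤-trans (*-monoˡ-≤ n (s≤s (m≤n⇒m≤1+n k≤n))) [2+n]*n≤K) (table-bounded t k u))
          (λ u → bounded-≤ (≤-trans (*-monoˡ-≤ n (s≤s (s≤s k≤n))) [2+n]*n≤K) (extend-bounded t k u)) ⨾ᴿ assignᴿ) runs
    where
    k≤n : k ≤ n
    k≤n = ≤-trans (m≤m+n k _) k≤

  pad : ℕ → Tree → Tree
  pad zero    T = T
  pad (suc j) T = nil ∙ pad j T

  pad-nil : ∀ j T → pad j (nil ∙ T) ≡ pad (suc j) T
  pad-nil zero    T = refl
  pad-nil (suc j) T = cong (nil ∙_) (pad-nil j T)

  drops-nil : ∀ i → drops i nil ≡ nil
  drops-nil zero    = refl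
  drops-nil (suc i) = cong tlᵗ (drops-nil i)

  hd-drops-pad-≡ : ∀ j x → hdᵗ (drops j (pad j (x ∙ nil))) ≡ x
  hd-drops-pad-≡ zero    x = refl
  hd-drops-pad-≡ (suc j) x = trans (cong hdᵗ (sym (drops-tl j (pad (suc j) (x ∙ nil))))) (hd-drops-pad-≡ j x)

  hd-drops-pad-≢ : ∀ i j {x} → i ≢ j → hdᵗ (drops i (pad j (x ∙ nil))) ≡ nil
  hd-drops-pad-≢ zero    zero    i≢j = contradiction refl i≢j
  hd-drops-pad-≢ zero    (suc j) i≢j = refl
  hd-drops-pad-≢ (suc i) zero {x} i≢j = cong hdᵗ (trans (sym (drops-tl i (x ∙ nil))) (drops-nil i))
  hd-drops-pad-≢ (suc i) (suc j) {x} i≢j =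
    trans (cong hdᵗ (sym (drops-tl i (pad (suc j) (x ∙ nil))))) (hd-drops-pad-≢ i j (i≢j ∘ cong suc))

  initialTable : Tree
  initialTable = pad (toℕ t) ((nil ∙ encodeVertex t ∙ nil) ∙ nil)

  initialTable-tabulates : Tabulates initialTable (initial t)
  initialTable-tabulates u with u ≟ t
  ... | yes refl = hd-drops-pad-≡ (toℕ t) _
  ... | no  u≢t  = hd-drops-pad-≢ (toℕ u) (toℕ t) (u≢t ∘ toℕ-injective)

  runs-pad : ∀ {io g s T′} j T → pad j T ≡ T′ →
    Iterate (var aᵛ) (tableᵛ := cons nil (var tableᵛ) ⨾ aᵛ := tl (var aᵛ))
      (store io g s T nil nil nil nil nil nil nil nil nil (unary j) nil nil)
      (store io g s T′ nil nil nil nil nil nil nil nil nil nil nil nil) j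
  runs-pad zero    T refl = doneᴿ refl
  runs-pad (suc j) T e    = againᴿ refl (assignᴿ ⨾ᴿ assignᴿ) (runs-pad j (nil ∙ T) (trans (pad-nil j T) e))

  runs-drops : ∀ {io g T′} j T → drops j T ≡ T′ →
    Iterate (var sourceᵛ) (tableᵛ := tl (var tableᵛ) ⨾ sourceᵛ := tl (var sourceᵛ))
      (store io g (unary j) T nil nil nil nil nil nil nil nil nil nil nil nil)
      (store io g nil T′ nil nil nil nil nil nil nil nil nil nil nil nil) j
  runs-drops zero    T refl = doneᴿ refl
  runs-drops (suc j) T e    = againᴿ refl (assignᴿ ⨾ᴿ assignᴿ) (runs-drops j (tlᵗ T) (trans (drops-tl j T) e))

  toℕ≤K : ∀ (v : Fin n) → toℕ v ≤ K
  toℕ≤K v = ≤-trans (<⇒≤ (toℕ<n v)) (≤-trans (m≤m+n n _) [2+n]*n≤K)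

  runs-approximate : ∀ s → ∃[ σ ]
    Run approximate
      (store (encodeInstance record { G = G ; s = s ; t = t })
        nil nil nil nil nil nil nil nil nil nil nil nil nil nil nil) σ
    × lookup σ inputᵛ ≡ tlᵗ (encodeEntry (table t n s))
  runs-approximate s
    with runs-rounds {encodeInstance record { G = G ; s = s ; t = t }} {encodeVertex s} (allFin n) 0
           initialTable-tabulates (≤-reflexive length-allFin)
    where
    length-allFin : length (allFin n) ≡ n
    length-allFin = length-tabulate {n = n} (λ i → i)
  ... | T , T≈ , rounds = _ ,
    (assignᴿ ⨾ᴿ assignᴿ ⨾ᴿ assignᴿ ⨾ᴿ assignᴿ ⨾ᴿ
     whileᴿ (runs-pad (toℕ t) _ refl) (toℕ≤K t) ⨾ᴿ
     assignᴿ ⨾ᴿ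
     whileᴿ rounds length-allFin≤K ⨾ᴿ
     whileᴿ (runs-drops (toℕ s) T refl) (toℕ≤K s) ⨾ᴿ
     assignᴿ) ,
    cong tlᵗ (trans (T≈ s) (cong (λ k → encodeEntry (table t k s)) (length-tabulate {n = n} (λ i → i))))

-- The polynomial time bound and the conclusion.

length≤size : ∀ ts → length ts ≤ size (encodeList ts)
length≤size []       = z≤n
length≤size (x ∷ ts) = s≤s (≤-trans (length≤size ts) (m≤n+m _ (size x)))

n≤size : ∀ i → Instance.n i ≤ size (encodeInstance i)
n≤size i = ≤-trans (≤-reflexive (sym (trans (length-map _ (allFin n)) (length-tabulate {n = n} (λ j → j)))))
  (≤-trans (length≤size (map _ (allFin n))) (≤-trans (m≤m+n _ _) (n≤1+n _)))
  where open Instance i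

open Graph using (maxDegree)

secludedPath : Program
secludedPath = record { extraVars = 15 ; body = approximate }

loopBound : ℕ → ℕ
loopBound N = (2 + N) * N

-- As `n` is at most the size of the encoding, the iteration bound can be stated in that size. The
-- run exists for every instance; connectedness enters when a path is read off the final entry of
-- `s`.
secludedPath-solves : ∀ i → ∃[ output ] ∃[ m ]
  Runs secludedPath (encodeInstance i) output m
  × m ≤ maxTime (loopBound (size (encodeInstance i))) approximate
  × ApproximateSolution (λ G c opt → c ≤[√ maxDegree G + 3 ]· opt) i output
secludedPath-solves i =
  _ , _ , (σ , Execution.Run.executes runs , output) , Execution.Run.bounded runs , approximates
  where
  open Instance i
  open BellmanFord G
  result = Correctness.runs-approximate G t (loopBound (size (encodeInstance i)))
             (*-mono-≤ (+-monoʳ-≤ 2 (n≤size i)) (n≤size i)) s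
  σ = proj₁ result
  runs = proj₁ (proj₂ result)
  output = proj₂ (proj₂ result)
  approximates : ApproximateSolution (λ G c opt → c ≤[√ maxDegree G + 3 ]· opt) i (tlᵗ (encodeEntry (table t n s)))
  approximates connected with table-approximates t connected
  ... | c , P , e , path , approx =
    P , cong (tlᵗ ∘ encodeEntry) e , path , λ P* optimal → approx P* (Graph.IsOptimal.isPath optimal)

-- Abstract, since the type checker must not evaluate the exponent.

abstract
  secludedPath-polynomial : IsPolynomial (λ N → maxTime (loopBound N) approximate)
  secludedPath-polynomial = poly-maxTime approximate (poly-* (poly-+ (poly-const 2) poly-id) poly-id)

size-nonZero : ∀ T → NonZero (size T)
size-nonZero nil     = _
size-nonZero (_ ∙ _) = _

theorem2 : SecludedPathApproximableWithin (λ G c opt → c ≤[√ maxDegree G + 3 ]· opt)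
theorem2 = secludedPath , factor , exponent , λ i →
  let output , m , runs , m≤ , solution = secludedPath-solves i
      N = size (encodeInstance i)
  in output , m , runs , ≤-trans m≤ (bound N {{size-nonZero (encodeInstance i)}}) , solution
  where
  factor   = proj₁ secludedPath-polynomial
  exponent = proj₁ (proj₂ secludedPath-polynomial)
  bound    = proj₂ (proj₂ secludedPath-polynomial)
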